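{- Every randomized algorithm for IncMax has (randomized) competitive ratio at least $1.447$.
   Context: IncMax. An instance is given by a countable set $U$ of elements and a monotone function $f:2^U\to\mathbb{R}_{\ge 0}$ (i.e. $f(X)\le f(Y)$ for $X\subseteq Y$) that is accountable: for every (finite non-empty) $X\subseteq U$ there exists $e\in X$ with $f(X\setminus\{e\})\ge f(X)-f(X)/|X|$. For $k\le n:=|U|$ (all $k\in\mathbb{N}$ if $U$ is infinite) let $\mathrm{Opt}(k)=\max\{f(X): X\subseteq U,\ |X|=k\}$ (assumed to exist). A deterministic solution is an order $\sigma=(e_1,e_2,\dots)$ of the elements of $U$. A randomized solution is a probability distribution $\Sigma=(E_1,E_2,\dots)$ over deterministic solutions ($E_1,E_2,\dots$ are random variables); it is $\alpha$-competitive if $\mathrm{Opt}(k)\le\alpha\,\mathbb{E}[f(\{E_1,\dots,E_k\})]$ for all $k$. A randomized algorithm is $\alpha$-competitive if it produces an $\alpha$-competitive randomized solution for every instance; its randomized competitive ratio is the infimum over all $\alpha\ge1$ for which it is $\alpha$-competitive. -}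

module Defs where

open import Data.Bool using (Bool; true; T; not; _∧_)
open import Data.Fin as Fin using (Fin)
open import Data.Integer as ℤ using (+_)
open import Data.List using (List; foldr)
open import Data.List.Relation.Unary.Unique.Propositional using (Unique)
open import Data.Nat as ℕ using (ℕ; NonZero)
import Data.Nat.Properties as ℕₚ
open import Data.Product using (Σ; ∃; ∃₂; _×_; _,_; proj₁; proj₂)
open import Data.Rational as ℚ using (ℚ; 0ℚ; 1ℚ; ½)
import Data.Rational.Properties as ℚₚ
open import Data.Rational.Solver using (module +-*-Solver)
open import Data.Unit using (⊤)
open import Data.Vec as Vec using (Vec)
import Data.Vec.Membership.DecPropositional as DecMembership
import Data.Vec.Properties as Vecₚ
open import Function using (_∘_; _↔_; _⇔_; Inverse)
open import Function.Properties.Inverse using (↔⇒↣; ↔-sym)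
open import Relation.Binary.Definitions using (DecidableEquality)
open import Relation.Binary.PropositionalEquality
  using (_≡_; _≢_; refl; sym; trans; cong; cong₂; subst)
open import Relation.Nullary using (¬_; does)
open import Relation.Nullary.Decidable using (via-injection)

IsCauchy : (ℕ → ℚ) → Set
IsCauchy x = ∀ ε → 0ℚ ℚ.< ε →
  ∃ λ N → ∀ m n → N ℕ.≤ m → N ℕ.≤ n → ℚ.∣ x m ℚ.- x n ∣ ℚ.< ε

record ℝ : Set where
  constructor mkℝ
  field
    seq    : ℕ → ℚ
    cauchy : IsCauchy seq

open ℝ public

private
  open +-*-Solver

  abstract
    0<½* : ∀ {ε} → 0ℚ ℚ.< ε → 0ℚ ℚ.< ½ ℚ.* ε
    0<½* {ε} 0<ε = ℚₚ.positive⁻¹ _ {{ℚₚ.pos*pos⇒pos ½ ε {{ℚ.positive 0<ε}}}}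

    ½+½ : ∀ ε → ½ ℚ.* ε ℚ.+ ½ ℚ.* ε ≡ ε
    ½+½ ε = trans (sym (ℚₚ.*-distribʳ-+ ε ½ ½)) (ℚₚ.*-identityˡ ε)

    const-cauchy : ∀ q → IsCauchy (λ _ → q)
    const-cauchy q ε 0<ε =
      0 , λ _ _ _ _ → subst (ℚ._< ε) (cong ℚ.∣_∣ (sym (ℚₚ.+-inverseʳ q))) 0<ε

    neg-cauchy : ∀ x → IsCauchy x → IsCauchy (λ n → ℚ.- x n)
    neg-cauchy x cx ε 0<ε with cx ε 0<ε
    ... | N , p = N , λ m n N≤m N≤n → subst (ℚ._< ε) (eq m n) (p m n N≤m N≤n)
      where
      eq : ∀ m n → ℚ.∣ x m ℚ.- x n ∣ ≡ ℚ.∣ ℚ.- x m ℚ.- (ℚ.- x n) ∣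
      eq m n = trans (sym (ℚₚ.∣-p∣≡∣p∣ _))
        (cong ℚ.∣_∣ (solve 2 (λ a b → :- (a :+ :- b) := :- a :+ :- (:- b)) refl (x m) (x n)))

    +-cauchy : ∀ x y → IsCauchy x → IsCauchy y → IsCauchy (λ n → x n ℚ.+ y n)
    +-cauchy x y cx cy ε 0<ε with cx (½ ℚ.* ε) (0<½* 0<ε) | cy (½ ℚ.* ε) (0<½* 0<ε)
    ... | N₁ , p | N₂ , q = N₁ ℕ.⊔ N₂ , bound
      where
      open ℚₚ.≤-Reasoning
      bound : ∀ m n → N₁ ℕ.⊔ N₂ ℕ.≤ m → N₁ ℕ.⊔ N₂ ℕ.≤ n →
              ℚ.∣ (x m ℚ.+ y m) ℚ.- (x n ℚ.+ y n) ∣ ℚ.< ε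
      bound m n N≤m N≤n = begin-strict
        ℚ.∣ (x m ℚ.+ y m) ℚ.- (x n ℚ.+ y n) ∣
          ≡⟨ cong ℚ.∣_∣ (solve 4 (λ a b c d → (a :+ b) :+ :- (c :+ d)
               := (a :+ :- c) :+ (b :+ :- d)) refl (x m) (y m) (x n) (y n)) ⟩
        ℚ.∣ (x m ℚ.- x n) ℚ.+ (y m ℚ.- y n) ∣
          ≤⟨ ℚₚ.∣p+q∣≤∣p∣+∣q∣ (x m ℚ.- x n) (y m ℚ.- y n) ⟩
        ℚ.∣ x m ℚ.- x n ∣ ℚ.+ ℚ.∣ y m ℚ.- y n ∣
          <⟨ ℚₚ.+-mono-< (p m n (ℕₚ.m⊔n≤o⇒m≤o N₁ N₂ N≤m) (ℕₚ.m⊔n≤o⇒m≤o N₁ N₂ N≤n))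
                         (q m n (ℕₚ.m⊔n≤o⇒n≤o N₁ N₂ N≤m) (ℕₚ.m⊔n≤o⇒n≤o N₁ N₂ N≤n)) ⟩
        ½ ℚ.* ε ℚ.+ ½ ℚ.* ε
          ≡⟨ ½+½ ε ⟩
        ε ∎

    eventually-bounded : ∀ x → IsCauchy x →
      ∃₂ λ K N → ℚ.Positive K × (∀ n → N ℕ.≤ n → ℚ.∣ x n ∣ ℚ.≤ K)
    eventually-bounded x cx with cx 1ℚ (ℚₚ.positive⁻¹ 1ℚ)
    ... | N , p = 1ℚ ℚ.+ ℚ.∣ x N ∣ , N
                , ℚₚ.pos+nonNeg⇒pos 1ℚ ℚ.∣ x N ∣ {{ℚₚ.∣-∣-nonNeg (x N)}} , bound
      where
      open ℚₚ.≤-Reasoning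
      bound : ∀ n → N ℕ.≤ n → ℚ.∣ x n ∣ ℚ.≤ 1ℚ ℚ.+ ℚ.∣ x N ∣
      bound n N≤n = begin
        ℚ.∣ x n ∣
          ≡⟨ cong ℚ.∣_∣ (solve 2 (λ a b → a := (a :+ :- b) :+ b) refl (x n) (x N)) ⟩
        ℚ.∣ (x n ℚ.- x N) ℚ.+ x N ∣
          ≤⟨ ℚₚ.∣p+q∣≤∣p∣+∣q∣ (x n ℚ.- x N) (x N) ⟩
        ℚ.∣ x n ℚ.- x N ∣ ℚ.+ ℚ.∣ x N ∣
          ≤⟨ ℚₚ.+-mono-≤ (ℚₚ.<⇒≤ (p n N N≤n ℕₚ.≤-refl)) ℚₚ.≤-refl ⟩
        1ℚ ℚ.+ ℚ.∣ x N ∣ ∎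

    scaled : ∀ K → ℚ.Positive K → ∀ ε → 0ℚ ℚ.< ε →
             ∃ λ δ → 0ℚ ℚ.< δ × K ℚ.* δ ≡ ½ ℚ.* ε
    scaled K K⁺ ε 0<ε =
        (½ ℚ.* ε) ℚ.* K⁻¹
      , ℚₚ.positive⁻¹ _ {{ℚₚ.pos*pos⇒pos (½ ℚ.* ε) {{ℚ.positive (0<½* 0<ε)}} K⁻¹ {{ℚₚ.1/pos⇒pos K {{K⁺}}}}}}
      , trans (solve 3 (λ k e i → k :* (e :* i) := e :* (k :* i)) refl K (½ ℚ.* ε) K⁻¹)
          (trans (cong ((½ ℚ.* ε) ℚ.*_) (ℚₚ.*-inverseʳ K {{K≢0}})) (ℚₚ.*-identityʳ _))
      where
      K≢0 : ℚ.NonZero K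
      K≢0 = ℚₚ.pos⇒nonZero K {{K⁺}}
      K⁻¹ : ℚ
      K⁻¹ = (ℚ.1/ K) {{K≢0}}

    ∣*∣< : ∀ a b c d → ℚ.Positive c → ℚ.∣ a ∣ ℚ.≤ c → ℚ.∣ b ∣ ℚ.< d → ℚ.∣ a ℚ.* b ∣ ℚ.< c ℚ.* d
    ∣*∣< a b c d c⁺ a≤c b<d = begin-strict
      ℚ.∣ a ℚ.* b ∣           ≡⟨ ℚₚ.∣p*q∣≡∣p∣*∣q∣ a b ⟩
      ℚ.∣ a ∣ ℚ.* ℚ.∣ b ∣     ≤⟨ ℚₚ.*-monoʳ-≤-nonNeg ℚ.∣ b ∣ {{ℚₚ.∣-∣-nonNeg b}} a≤c ⟩
      c ℚ.* ℚ.∣ b ∣           <⟨ ℚₚ.*-monoʳ-<-pos c {{c⁺}} b<d ⟩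
      c ℚ.* d                 ∎
      where open ℚₚ.≤-Reasoning

    *-difference : ∀ a b c d →
      a ℚ.* b ℚ.- c ℚ.* d ≡ b ℚ.* (a ℚ.- c) ℚ.+ c ℚ.* (b ℚ.- d)
    *-difference = solve 4 (λ a b c d → a :* b :+ :- (c :* d)
                     := b :* (a :+ :- c) :+ c :* (b :+ :- d)) refl

    ∣*-*∣< : ∀ a b c d K L δ η → ℚ.Positive K → ℚ.Positive L →
             ℚ.∣ c ∣ ℚ.≤ K → ℚ.∣ b ∣ ℚ.≤ L → ℚ.∣ a ℚ.- c ∣ ℚ.< δ → ℚ.∣ b ℚ.- d ∣ ℚ.< η →
             ℚ.∣ a ℚ.* b ℚ.- c ℚ.* d ∣ ℚ.< L ℚ.* δ ℚ.+ K ℚ.* η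
    ∣*-*∣< a b c d K L δ η K⁺ L⁺ c≤K b≤L a-c<δ b-d<η = begin-strict
      ℚ.∣ a ℚ.* b ℚ.- c ℚ.* d ∣
        ≡⟨ cong ℚ.∣_∣ (*-difference a b c d) ⟩
      ℚ.∣ b ℚ.* (a ℚ.- c) ℚ.+ c ℚ.* (b ℚ.- d) ∣
        ≤⟨ ℚₚ.∣p+q∣≤∣p∣+∣q∣ (b ℚ.* (a ℚ.- c)) (c ℚ.* (b ℚ.- d)) ⟩
      ℚ.∣ b ℚ.* (a ℚ.- c) ∣ ℚ.+ ℚ.∣ c ℚ.* (b ℚ.- d) ∣
        <⟨ ℚₚ.+-mono-< (∣*∣< b (a ℚ.- c) L δ L⁺ b≤L a-c<δ) (∣*∣< c (b ℚ.- d) K η K⁺ c≤K b-d<η) ⟩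
      L ℚ.* δ ℚ.+ K ℚ.* η ∎
      where open ℚₚ.≤-Reasoning

    *-cauchy : ∀ x y → IsCauchy x → IsCauchy y → IsCauchy (λ n → x n ℚ.* y n)
    *-cauchy x y cx cy ε 0<ε =
      let K , N₁ , K⁺ , x≤K = eventually-bounded x cx
          L , N₂ , L⁺ , y≤L = eventually-bounded y cy
          δ , 0<δ , Lδ      = scaled L L⁺ ε 0<ε
          η , 0<η , Kη      = scaled K K⁺ ε 0<ε
          N₃ , x<δ          = cx δ 0<δ
          N₄ , y<η          = cy η 0<η
          M₁ = N₁ ℕ.⊔ N₂
          M₂ = N₃ ℕ.⊔ N₄
      in M₁ ℕ.⊔ M₂ , λ m n N≤m N≤n →
        let M₁≤m = ℕₚ.m⊔n≤o⇒m≤o M₁ M₂ N≤m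
            M₁≤n = ℕₚ.m⊔n≤o⇒m≤o M₁ M₂ N≤n
            M₂≤m = ℕₚ.m⊔n≤o⇒n≤o M₁ M₂ N≤m
            M₂≤n = ℕₚ.m⊔n≤o⇒n≤o M₁ M₂ N≤n
        in subst (ℚ.∣ x m ℚ.* y m ℚ.- x n ℚ.* y n ∣ ℚ.<_)
             (trans (cong₂ ℚ._+_ Lδ Kη) (½+½ ε))
             (∣*-*∣< (x m) (y m) (x n) (y n) K L δ η K⁺ L⁺
               (x≤K n (ℕₚ.m⊔n≤o⇒m≤o N₁ N₂ M₁≤n))
               (y≤L m (ℕₚ.m⊔n≤o⇒n≤o N₁ N₂ M₁≤m))
               (x<δ m n (ℕₚ.m⊔n≤o⇒m≤o N₃ N₄ M₂≤m) (ℕₚ.m⊔n≤o⇒m≤o N₃ N₄ M₂≤n))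
               (y<η m n (ℕₚ.m⊔n≤o⇒n≤o N₃ N₄ M₂≤m) (ℕₚ.m⊔n≤o⇒n≤o N₃ N₄ M₂≤n)))

fromℚ : ℚ → ℝ
fromℚ q = mkℝ (λ _ → q) (const-cauchy q)

0ℝ 1ℝ : ℝ
0ℝ = fromℚ 0ℚ
1ℝ = fromℚ 1ℚ

infix  8 -_
infixl 7 _*_ _÷_
infixl 6 _+_ _-_
infix  4 _≤_ _≈_

_+_ _*_ : ℝ → ℝ → ℝ
mkℝ x cx + mkℝ y cy = mkℝ (λ n → x n ℚ.+ y n) (+-cauchy x y cx cy)
mkℝ x cx * mkℝ y cy = mkℝ (λ n → x n ℚ.* y n) (*-cauchy x y cx cy)

-_ : ℝ → ℝ
- mkℝ x cx = mkℝ (λ n → ℚ.- x n) (neg-cauchy x cx)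

_-_ : ℝ → ℝ → ℝ
x - y = x + (- y)

_÷_ : ℝ → (n : ℕ) .{{_ : NonZero n}} → ℝ
x ÷ n = x * fromℚ (+ 1 ℚ./ n)

-- The order of the limits, so it is insensitive to the representing sequences.
_≤_ _≈_ : ℝ → ℝ → Set
x ≤ y = ∀ ε → 0ℚ ℚ.< ε → ∃ λ N → ∀ n → N ℕ.≤ n → seq x n ℚ.≤ seq y n ℚ.+ ε
x ≈ y = x ≤ y × y ≤ x

∑ : {I : Set} → (I → ℝ) → List I → ℝ
∑ a = foldr (λ i s → a i + s) 0ℝ

-- The value of a (possibly infinite) sum of non-negative terms is the
-- supremum of its finite partial sums.
HasSum : {I : Set} → (I → ℝ) → ℝ → Set
HasSum a s =
    (∀ is → Unique is → ∑ a is ≤ s)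
  × (∀ ε → 0ℚ ℚ.< ε → ∃ λ is → Unique is × s ≤ ∑ a is + fromℚ ε)

𝒫 : Set → Set
𝒫 U = U → Bool

infix 4 _⊆_
_⊆_ : {U : Set} → 𝒫 U → 𝒫 U → Set
X ⊆ Y = ∀ u → T (X u) → T (Y u)

HasCard : {U : Set} → 𝒫 U → ℕ → Set
HasCard {U} X k = Fin k ↔ Σ U (T ∘ X)

record ProbabilityMeasure (Ω : Set) : Set₁ where
  field
    Event   : 𝒫 Ω → Set
    full    : Event (λ _ → true)
    ∁-event : ∀ {A} → Event A → Event (not ∘ A)
    -- A union need not have a computable characteristic function, so it
    -- is given together with one.
    ⋃-event : ∀ {A} (As : ℕ → 𝒫 Ω) → (∀ i → Event (As i)) →
              (∀ ω → T (A ω) ⇔ (∃ λ i → T (As i ω))) → Event A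

    ℙ       : ∀ {A} → Event A → ℝ
    ℙ-nonneg : ∀ {A} (a : Event A) → 0ℝ ≤ ℙ a
    ℙ-full  : ℙ full ≈ 1ℝ
    -- With all As i after the first empty, this also shows that ℙ does
    -- not depend on the proof of Event A.
    ℙ-⋃     : ∀ {A} (a : Event A) (As : ℕ → 𝒫 Ω) (as : ∀ i → Event (As i)) →
              (∀ ω → T (A ω) ⇔ (∃ λ i → T (As i ω))) →
              (∀ {i j} → i ≢ j → ∀ ω → ¬ (T (As i ω) × T (As j ω))) →
              HasSum (λ i → ℙ (as i)) (ℙ a)

data Cardinality : Set where
  finite : ℕ → Cardinality
  ℵ₀     : Cardinality

Position : Cardinality → Set
Position (finite n) = Fin n
Position ℵ₀         = ℕ

infix 4 _≤ᶜ_
_≤ᶜ_ : ℕ → Cardinality → Set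
k ≤ᶜ finite n = k ℕ.≤ n
k ≤ᶜ ℵ₀       = ⊤

_≟ₚ_ : ∀ {c} → DecidableEquality (Position c)
_≟ₚ_ {finite n} = Fin._≟_
_≟ₚ_ {ℵ₀}       = ℕ._≟_

-- Position i (counting from 0), for i < k ≤ c.
nth : ∀ {k} c → k ≤ᶜ c → Fin k → Position c
nth (finite n) k≤n i = Fin.inject≤ i k≤n
nth ℵ₀         _   i = Fin.toℕ i

record Countable (U : Set) : Set where
  field
    card        : Cardinality
    enumeration : Position card ↔ U

  infix 4 _≟_
  _≟_ : DecidableEquality U
  _≟_ = via-injection (↔⇒↣ (↔-sym enumeration)) _≟ₚ_

  infixl 6 _∖_
  _∖_ : 𝒫 U → U → 𝒫 U
  (X ∖ e) u = X u ∧ not (does (u ≟ e))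

  open DecMembership _≟_ using (_∈?_)

  elements : ∀ {k} → Vec U k → 𝒫 U
  elements w u = does (u ∈? w)

  Order : Set
  Order = Position card ↔ U

  prefix : ∀ k → k ≤ᶜ card → Order → Vec U k
  prefix k k≤c σ = Vec.tabulate (Inverse.to σ ∘ nth card k≤c)

  startsWith : ∀ {k} → k ≤ᶜ card → Vec U k → 𝒫 Order
  startsWith {k} k≤c w σ = does (Vecₚ.≡-dec _≟_ (prefix k k≤c σ) w)

record Instance : Set₁ where
  field
    U         : Set
    countable : Countable U
  open Countable countable public
  field
    f           : 𝒫 U → ℝ
    f-nonneg    : ∀ X → 0ℝ ≤ f X
    monotone    : ∀ X Y → X ⊆ Y → f X ≤ f Y
    accountable : ∀ X n .{{_ : NonZero n}} → HasCard X n →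
                  ∃ λ e → T (X e) × f X - f X ÷ n ≤ f (X ∖ e)
    opt-exists  : ∀ k → k ≤ᶜ card →
                  ∃ λ X → HasCard X k × (∀ Y → HasCard Y k → f Y ≤ f X)

  Opt : ∀ k → k ≤ᶜ card → ℝ
  Opt k k≤c = f (proj₁ (opt-exists k k≤c))

record RandomizedSolution (I : Instance) : Set₁ where
  open Instance I
  field
    distribution : ProbabilityMeasure Order
  open ProbabilityMeasure distribution public
  field
    -- (E₁,…,E_k) is a random variable with values in U^k
    prefix-event : ∀ {k} (k≤c : k ≤ᶜ card) (w : Vec U k) → Event (startsWith k≤c w)

  -- v = 𝔼[f({E₁,…,E_k})].  As U^k is countable, the expectation is the
  -- sum over the possible values of (E₁,…,E_k).
  IsExpectedValue : ∀ k → k ≤ᶜ card → ℝ → Set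
  IsExpectedValue k k≤c v =
    HasSum (λ (w : Vec U k) → ℙ (prefix-event k≤c w) * f (elements w)) v

  -- The expectation always exists classically, being bounded by Opt k;
  -- here its existence is part of the assertion.
  Competitive : ℝ → Set
  Competitive α = ∀ k (k≤c : k ≤ᶜ card) →
    ∃ λ v → IsExpectedValue k k≤c v × Opt k k≤c ≤ α * v

RandomizedAlgorithm : Set₁
RandomizedAlgorithm = (I : Instance) → RandomizedSolution I

AlgorithmCompetitive : RandomizedAlgorithm → ℝ → Set₁
AlgorithmCompetitive A α = ∀ I → RandomizedSolution.Competitive (A I) α

-- c ≤ inf S, where inf ∅ = ∞
infix 4 _≤inf_
_≤inf_ : ℝ → (ℝ → Set₁) → Set₁
c ≤inf S = ∀ α → S α → c ≤ α

CompetitiveRatioAtLeast : ℝ → RandomizedAlgorithm → Set₁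
CompetitiveRatioAtLeast c A = c ≤inf λ α → 1ℝ ≤ α × AlgorithmCompetitive A α

-- Yao's principle on one separable instance: the ground set consists of
-- blocks i with sizes sᵢ and densities dᵢ, decreasing in i, and
-- f(X) = maxᵢ dᵢ · min(sᵢ, |X ∩ block i|).  Weights pₖ on finitely many
-- times k are chosen so that ∑ pₖ f({σ₁,…,σₖ}) ≤ V for every order σ, while
-- 1447 V ≤ 1000 ∑ pₖ Opt(k).
--
-- To bound the sum for a fixed order, run through the blocks by increasing
-- index and look at the last time e at which block i attains the maximum.  If
-- X elements of denser blocks have been spent before, and block i supplies x
-- elements up to time e, it contributes at most dᵢ · min(x, k - X) at each
-- time k ≤ e, and X + x elements are spent afterwards.  The optimum over such
-- schedules is convex in x as long as k - X does not cross x for any time k,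
-- so it suffices to consider x = sᵢ and the finitely many x = k - X.  The
-- remaining finite optimisation is evaluated by branch and bound.
module Submission where

-- Convexity dictates the form of the recursion `best`: none of its case distinctions may depend on
-- the number `X` of elements already spent. Hence a finished block is credited with all its `s`
-- elements at every time later than `s`, and a separate bound `q`, which may lag behind `X`,
-- governs at which times a block may be abandoned. Both choices only increase the value, and each
-- block is left with about a dozen options although it may have more than a million elements.
--
-- On the probabilistic side, the expectations at different times come from separate families of
-- events. Additivity of the measure rewrites all of them as sums over the prefixes of one common
-- length `K`, the largest time; only then can they be added with weights. The objective takes
-- natural values, so the combinatorics stays in `ℕ` and the real numbers that matter are the
-- probabilities and `α`.
--
-- The weighted times are the block sizes themselves: at time `sᵢ` an optimal set consists of `sᵢ`
-- elements of block `i`.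

module Schedules where

  open import Data.Bool using (Bool; true; false; if_then_else_; _∧_; T)
  open import Data.Bool.Properties using (T-∧)
  open import Data.Empty using (⊥-elim)
  open import Data.List using (List; []; _∷_; map)
  open import Data.List.Properties using (map-∘; map-cong)
  open import Data.List.Membership.Propositional using (_∈_)
  open import Data.List.Relation.Unary.All using (All; []; _∷_; lookup)
  open import Data.List.Relation.Unary.AllPairs using (AllPairs; []; _∷_)
  open import Data.List.Relation.Unary.Any using (here; there)
  open import Data.Nat
  open import Data.Nat.Properties
  open import Data.Product using (∃; _×_; _,_; proj₁; proj₂)
  open import Data.Sum using (_⊎_; inj₁; inj₂)
  open import Data.Unit using (tt)
  open import Function using (_∘_; Equivalence)
  open import Relation.Binary.PropositionalEquality
  open import Relation.Nullary using (¬_; Dec; yes; no; contradiction)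
  open import Relation.Nullary.Decidable using (_×-dec_)
  open import Algebra.Properties.CommutativeSemigroup +-commutativeSemigroup using (interchange)

  -- Weighted totals and convex functions on the naturals.

  infixl 6 _⊔ᶠ_

  _⊔ᶠ_ : (ℕ → ℕ) → (ℕ → ℕ) → ℕ → ℕ
  (b ⊔ᶠ g) k = b k ⊔ g k

  total : List (ℕ × ℕ) → (ℕ → ℕ) → ℕ
  total []             b = 0
  total ((k , p) ∷ ts) b = p * b k + total ts b

  total-cong : ∀ ts {b c} → (∀ k → b k ≡ c k) → total ts b ≡ total ts c
  total-cong []             eq = refl
  total-cong ((k , p) ∷ ts) eq = cong₂ _+_ (cong (p *_) (eq k)) (total-cong ts eq)

  -- Stated with sums because subtraction on `ℕ` truncates.
  record Convex (g : ℕ → ℕ) : Set where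
    constructor convex
    field 2nd-difference : ∀ n → g (1 + n) + g (1 + n) ≤ g n + g (2 + n)

    step-up : ∀ n → g n ≤ g (1 + n) → g (1 + n) ≤ g (2 + n)
    step-up n le = +-cancelˡ-≤ (g (1 + n)) _ _ (≤-trans (2nd-difference n) (+-monoˡ-≤ _ le))

    rising : ∀ n → g n ≤ g (1 + n) → ∀ j → g n ≤ g (j + n) × g (j + n) ≤ g (1 + j + n)
    rising n up zero    = ≤-refl , up
    rising n up (suc j) with rising n up j
    ... | le , up′ = ≤-trans le up′ , step-up (j + n) up′

    -- Going up from `a`, the values stay below `g a` until some step does not decrease; by
    -- convexity no later step decreases either, so from there on `g b` is an upper bound.
    endpoints : ∀ {a b x} → a ≤ x → x ≤ b → g x ≤ g a ⊔ g b
    endpoints {a} {b} {x} a≤x x≤b with trend (x ∸ a)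
      where
      trend : ∀ n → g (n + a) ≤ g a ⊎ g (n + a) ≤ g (1 + n + a)
      trend zero = inj₁ ≤-refl
      trend (suc n) with trend n
      ... | inj₂ up = inj₂ (step-up (n + a) up)
      ... | inj₁ le with ≤-total (g (n + a)) (g (1 + n + a))
      ...   | inj₁ up   = inj₂ (step-up (n + a) up)
      ...   | inj₂ down = inj₁ (≤-trans down le)
    ... | inj₁ le rewrite m∸n+n≡m a≤x = ≤-trans le (m≤m⊔n _ _)
    ... | inj₂ up rewrite m∸n+n≡m a≤x = ≤-trans
      (subst (λ y → g x ≤ g y) (m∸n+n≡m x≤b) (proj₁ (rising x up (b ∸ x)))) (m≤n⊔m (g a) _)

  open Convex

  Convex-cong : ∀ {g h} → (∀ n → g n ≡ h n) → Convex g → Convex h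
  Convex-cong eq cg .2nd-difference n =
    subst₂ _≤_ (cong₂ _+_ (eq (1 + n)) (eq (1 + n))) (cong₂ _+_ (eq n) (eq (2 + n))) (2nd-difference cg n)

  Convex-const : ∀ c → Convex (λ _ → c)
  Convex-const c .2nd-difference n = ≤-refl

  Convex-⊔ : ∀ {g h} → Convex g → Convex h → Convex (λ n → g n ⊔ h n)
  Convex-⊔ {g} {h} cg ch .2nd-difference n with ⊔-sel (g (1 + n)) (h (1 + n))
  ... | inj₁ eq rewrite eq = ≤-trans (2nd-difference cg n) (+-mono-≤ (m≤m⊔n (g n) _) (m≤m⊔n (g (2 + n)) _))
  ... | inj₂ eq rewrite eq = ≤-trans (2nd-difference ch n) (+-mono-≤ (m≤n⊔m (g n) _) (m≤n⊔m (g (2 + n)) _))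

  Convex-+ : ∀ {g h} → Convex g → Convex h → Convex (λ n → g n + h n)
  Convex-+ {g} {h} cg ch .2nd-difference n = subst₂ _≤_
    (interchange (g (1 + n)) _ _ _) (interchange (g n) _ _ _)
    (+-mono-≤ (2nd-difference cg n) (2nd-difference ch n))

  Convex-* : ∀ c {g} → Convex g → Convex (λ n → c * g n)
  Convex-* c {g} cg .2nd-difference n =
    subst₂ _≤_ (*-distribˡ-+ c _ _) (*-distribˡ-+ c (g n) _) (*-monoʳ-≤ c (2nd-difference cg n))

  Convex-id : Convex (λ n → n)
  Convex-id .2nd-difference n = ≤-reflexive (sym (+-suc n (suc n)))

  Convex-∸ : ∀ k X → Convex (λ n → k ∸ (n + X))
  Convex-∸ k X .2nd-difference n = go k (n + X)
    where
    go : ∀ k y → (k ∸ suc y) + (k ∸ suc y) ≤ (k ∸ y) + (k ∸ suc (suc y))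
    go zero          y       = subst (λ z → z + z ≤ (0 ∸ y) + z) (sym (0∸n≡0 (suc y))) z≤n
    go (suc zero)    zero    = z≤n
    go (suc (suc k)) zero    = ≤-reflexive (cong suc (+-suc k k))
    go (suc k)       (suc y) = go k y

  -- The primed operations compute on literals without unary recursion.
  m⊓′n≤m : ∀ m n → m ⊓′ n ≤ m
  m⊓′n≤m m n = subst (_≤ m) (⊓≡⊓′ m n) (m⊓n≤m m n)

  m⊓′n≤n : ∀ m n → m ⊓′ n ≤ n
  m⊓′n≤n m n = subst (_≤ n) (⊓≡⊓′ m n) (m⊓n≤n m n)

  ⊓′-glb : ∀ {m n o} → o ≤ m → o ≤ n → o ≤ m ⊓′ n
  ⊓′-glb {m} {n} {o} o≤m o≤n = subst (o ≤_) (⊓≡⊓′ m n) (⊓-glb o≤m o≤n)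

  m≤m⊔′n : ∀ m n → m ≤ m ⊔′ n
  m≤m⊔′n m n = subst (m ≤_) (⊔≡⊔′ m n) (m≤m⊔n m n)

  m≤n⊔′m : ∀ m n → m ≤ n ⊔′ m
  m≤n⊔′m m n = subst (m ≤_) (⊔≡⊔′ n m) (m≤n⊔m n m)

  -- Payoffs at time k of a block of density d started after X other elements:
  -- finished (all s elements taken), or abandoned at time t.
  completed : ℕ → ℕ → ℕ → ℕ → ℕ
  completed s d X k = d * (if s <ᵇ k then s else k ∸ X)

  stopped : ℕ → ℕ → ℕ → ℕ → ℕ
  stopped d t X k = d * (k ⊓′ t ∸ X)

  -- The finite optimisation over schedules: monotonicity and convexity.

  module _ (Ts : List (ℕ × ℕ)) where

    infix 4 _≼_
    _≼_ : (ℕ → ℕ) → (ℕ → ℕ) → Set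
    b ≼ c = ∀ {k p} → (k , p) ∈ Ts → b k ≤ c k

    total-mono : ∀ {b c} → b ≼ c → total Ts b ≤ total Ts c
    total-mono {b} {c} le = go Ts (λ m → m)
      where
      go : ∀ ts → (∀ {t} → t ∈ ts → t ∈ Ts) → total ts b ≤ total ts c
      go []             sub = z≤n
      go ((k , p) ∷ ts) sub = +-mono-≤ (*-monoʳ-≤ p (le (sub (here refl)))) (go ts (sub ∘ there))

    -- best is q b X bounds the total payoff when the blocks still to be used are
    -- among is, X elements have been spent, and the payoff at time k is already at
    -- least b k.  A block may be abandoned only at times after q.
    best : List (ℕ × ℕ) → ℕ → (ℕ → ℕ) → ℕ → ℕ
    bestUsing : ℕ → ℕ → List (ℕ × ℕ) → ℕ → (ℕ → ℕ) → ℕ → List (ℕ × ℕ) → ℕ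
    best []             q b X = total Ts b
    best ((s , d) ∷ is) q b X = best is q b X ⊔ bestUsing s d is q b X Ts
    bestUsing s d is q b X []             = best is q (b ⊔ᶠ completed s d X) (X + s)
    bestUsing s d is q b X ((t , _) ∷ ts) = if (q <ᵇ t) ∧ (t <ᵇ suc s)
      then best is q (b ⊔ᶠ stopped d t X) t ⊔ bestUsing s d is t b X ts
      else bestUsing s d is q b X ts

    ⊔ᶠ-mono : ∀ {b b′ c c′} → b ≼ b′ → c ≼ c′ → b ⊔ᶠ c ≼ b′ ⊔ᶠ c′
    ⊔ᶠ-mono le le′ m = ⊔-mono-≤ (le m) (le′ m)

    ⊔ᶠ-monoʳ : ∀ b {c c′} → c ≼ c′ → b ⊔ᶠ c ≼ b ⊔ᶠ c′
    ⊔ᶠ-monoʳ b le {k} m = ⊔-monoʳ-≤ (b k) (le m)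

    completed-anti : ∀ s d {X X′} → X ≤ X′ → ∀ k → completed s d X′ k ≤ completed s d X k
    completed-anti s d le k with s <ᵇ k
    ... | true  = ≤-refl
    ... | false = *-monoʳ-≤ d (∸-monoʳ-≤ k le)

    stopped-anti : ∀ d t {X X′} → X ≤ X′ → ∀ k → stopped d t X′ k ≤ stopped d t X k
    stopped-anti d t le k = *-monoʳ-≤ d (∸-monoʳ-≤ (k ⊓′ t) le)

    -- Options are joined by `⊔`, so the larger `q′` merely loses those at times `t` with
    -- `q < t ≤ q′`; payoffs can only fall as more elements are spent.
    best-mono : ∀ is {q q′ b b′ X X′} → q ≤ q′ → b′ ≼ b → X ≤ X′ → best is q′ b′ X′ ≤ best is q b X
    bestUsing-mono : ∀ s d is ts {q q′ b b′ X X′} → q ≤ q′ → b′ ≼ b → X ≤ X′ →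
      bestUsing s d is q′ b′ X′ ts ≤ bestUsing s d is q b X ts
    best-mono []             q≤ b≼ X≤ = total-mono b≼
    best-mono ((s , d) ∷ is) q≤ b≼ X≤ = ⊔-mono-≤ (best-mono is q≤ b≼ X≤) (bestUsing-mono s d is Ts q≤ b≼ X≤)
    bestUsing-mono s d is [] q≤ b≼ X≤ =
      best-mono is q≤ (⊔ᶠ-mono b≼ (λ {k} _ → completed-anti s d X≤ k)) (+-monoˡ-≤ s X≤)
    bestUsing-mono s d is ((t , _) ∷ ts) {q} {q′} q≤ b≼ X≤
      with q <ᵇ t in eq | q′ <ᵇ t in eq′ | t <ᵇ suc s
    ... | true  | true  | true  = ⊔-mono-≤
      (best-mono is q≤ (⊔ᶠ-mono b≼ (λ {k} _ → stopped-anti d t X≤ k)) ≤-refl)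
      (bestUsing-mono s d is ts ≤-refl b≼ X≤)
    ... | true  | false | true  = ≤-trans
      (bestUsing-mono s d is ts (≮⇒≥ λ lt → subst T eq′ (<⇒<ᵇ lt)) b≼ X≤) (m≤n⊔m _ _)
    ... | false | true  | true  = ⊥-elim (subst T eq (<⇒<ᵇ (≤-<-trans q≤ (<ᵇ⇒< q′ t (subst T (sym eq′) tt)))))
    ... | false | false | true  = bestUsing-mono s d is ts q≤ b≼ X≤
    ... | true  | true  | false = bestUsing-mono s d is ts q≤ b≼ X≤
    ... | true  | false | false = bestUsing-mono s d is ts q≤ b≼ X≤
    ... | false | true  | false = bestUsing-mono s d is ts q≤ b≼ X≤
    ... | false | false | false = bestUsing-mono s d is ts q≤ b≼ X≤

    -- As functions of the number of elements taken from a block, the elements spent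
    -- later on are constant once the block is abandoned at a fixed time, and
    -- increase by the same number otherwise.
    data Position : Set where
      fixed moving : ℕ → Position

    at : Position → ℕ → ℕ
    at (fixed X)  n = X
    at (moving X) n = n + X

    _⊹_ : Position → ℕ → Position
    fixed X  ⊹ s = fixed (X + s)
    moving X ⊹ s = moving (X + s)

    at-⊹ : ∀ π s n → at (π ⊹ s) n ≡ at π n + s
    at-⊹ (fixed X)  s n = refl
    at-⊹ (moving X) s n = sym (+-assoc n X s)

    Convex-∸at : ∀ k π → Convex (λ n → k ∸ at π n)
    Convex-∸at k (fixed X)  = Convex-const (k ∸ X)
    Convex-∸at k (moving X) = Convex-∸ k X

    Convex-completed : ∀ s d π k → Convex (λ n → completed s d (at π n) k)
    Convex-completed s d π k with s <ᵇ k
    ... | true  = Convex-const (d * s)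
    ... | false = Convex-* d (Convex-∸at k π)

    Convex-total : ∀ ts (β : ℕ → ℕ → ℕ) → (∀ k → Convex (λ n → β n k)) → Convex (λ n → total ts (β n))
    Convex-total []             β cβ = Convex-const 0
    Convex-total ((k , p) ∷ ts) β cβ =
      Convex-+ (Convex-* p (cβ k)) (Convex-total ts β cβ)

    -- Since `q` does not move with `n` and no test looks at the position, the same options are
    -- present for all `n`. The value is then built from convex payoffs by maxima, sums and
    -- multiples.
    best-convex : ∀ is q (β : ℕ → ℕ → ℕ) → (∀ k → Convex (λ n → β n k)) → ∀ π →
      Convex (λ n → best is q (β n) (at π n))
    bestUsing-convex : ∀ s d is q (β : ℕ → ℕ → ℕ) → (∀ k → Convex (λ n → β n k)) → ∀ π ts →
      Convex (λ n → bestUsing s d is q (β n) (at π n) ts)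
    best-convex [] q β cβ π = Convex-total Ts β cβ
    best-convex ((s , d) ∷ is) q β cβ π =
      Convex-⊔
        (best-convex is q β cβ π) (bestUsing-convex s d is q β cβ π Ts)
    bestUsing-convex s d is q β cβ π [] =
      Convex-cong (λ n → cong (best is q (β n ⊔ᶠ completed s d (at π n))) (at-⊹ π s n))
        (best-convex is q (λ n → β n ⊔ᶠ completed s d (at π n))
          (λ k → Convex-⊔ (cβ k) (Convex-completed s d π k)) (π ⊹ s))
    bestUsing-convex s d is q β cβ π ((t , _) ∷ ts) with (q <ᵇ t) ∧ (t <ᵇ suc s)
    ... | true  = Convex-⊔
      (best-convex is q (λ n → β n ⊔ᶠ stopped d t (at π n))
        (λ k → Convex-⊔ (cβ k) (Convex-* d (Convex-∸at (k ⊓′ t) π))) (fixed t))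
      (bestUsing-convex s d is t β cβ π ts)
    ... | false = bestUsing-convex s d is q β cβ π ts

    -- Reducing an arbitrary interruption to finitely many breakpoints.

    module _ (s d : ℕ) (is : List (ℕ × ℕ)) (b : ℕ → ℕ) (X : ℕ) where

      interrupted : ℕ → ℕ → ℕ
      interrupted x k = d * (x ⊓ (k ∸ X))

      -- For x between q - X and the next t - X this agrees with interrupted at the
      -- times in Ts, and it is linear in x.
      piece : ℕ → ℕ → ℕ → ℕ
      piece q x k = d * (if q <ᵇ k then x else k ∸ X)

      pieceBest : ℕ → ℕ → ℕ
      pieceBest q x = best is q (b ⊔ᶠ piece q x) (x + X)

      pieceBest-convex : ∀ q → Convex (pieceBest q)
      pieceBest-convex q = best-convex is q (λ x → b ⊔ᶠ piece q x)
        (λ k → Convex-⊔ (Convex-const (b k)) (Convex-* d (linear k))) (moving X)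
        where
        linear : ∀ k → Convex (λ x → if q <ᵇ k then x else k ∸ X)
        linear k with q <ᵇ k
        ... | true  = Convex-id
        ... | false = Convex-const (k ∸ X)

      interrupted≤piece : ∀ q x k → interrupted x k ≤ piece q x k
      interrupted≤piece q x k with q <ᵇ k
      ... | true  = *-monoʳ-≤ d (m⊓n≤m x _)
      ... | false = *-monoʳ-≤ d (m⊓n≤n x _)

      -- Only the times in `ts` can still bend the payoff as a function of `x`. At a time up to `q`
      -- it no longer grows with `x`, and at a time after `s` the bound `completed` grants all `s`
      -- elements, so that no breakpoint is required there.
      Covered : ℕ → List (ℕ × ℕ) → Set
      Covered q ts = ∀ {k p} → (k , p) ∈ Ts → k ≤ q ⊎ s < k ⊎ (k , p) ∈ ts

      Sorted : List (ℕ × ℕ) → Set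
      Sorted = AllPairs (λ t u → proj₁ t ≤ proj₁ u)

      -- By `Covered` and sortedness no time of `Ts` lies strictly between `q` and `t`, so a time at
      -- which the piece still grows is at least `t`.
      piece-right : ∀ q t {p} ts → Sorted ((t , p) ∷ ts) → Covered q ((t , p) ∷ ts) → q ≤ t → t ≤ s →
        piece q (t ∸ X) ≼ stopped d t X
      piece-right q t ts (t≤ ∷ _) cov q≤t t≤s {k} m with q <ᵇ k in eq
      ... | false = *-monoʳ-≤ d (∸-monoˡ-≤ X (⊓′-glb ≤-refl (≤-trans k≤q q≤t)))
        where
        k≤q : k ≤ q
        k≤q = ≮⇒≥ λ lt → subst T eq (<⇒<ᵇ lt)
      ... | true = *-monoʳ-≤ d (∸-monoˡ-≤ X (⊓′-glb t≤k ≤-refl))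
        where
        q<k : q < k
        q<k = <ᵇ⇒< q k (subst T (sym eq) tt)
        t≤k : t ≤ k
        t≤k with cov m
        ... | inj₁ k≤q = contradiction k≤q (<⇒≱ q<k)
        ... | inj₂ (inj₁ s<k) = ≤-trans t≤s (<⇒≤ s<k)
        ... | inj₂ (inj₂ (here refl)) = ≤-refl
        ... | inj₂ (inj₂ (there k∈)) = lookup t≤ k∈

      piece-left : ∀ t k → piece t (t ∸ X) k ≤ stopped d t X k
      piece-left t k with t <ᵇ k in eq
      ... | true  = *-monoʳ-≤ d (∸-monoˡ-≤ X (⊓′-glb (<⇒≤ (<ᵇ⇒< t k (subst T (sym eq) tt))) ≤-refl))
      ... | false = *-monoʳ-≤ d (∸-monoˡ-≤ X (⊓′-glb ≤-refl (≮⇒≥ λ lt → subst T eq (<⇒<ᵇ lt))))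

      t≤[t∸X]+X : ∀ t → t ≤ t ∸ X + X
      t≤[t∸X]+X t = subst (t ≤_) (+-comm X (t ∸ X)) (m≤n+m∸n t X)

      -- A sweep through the breakpoints up to the piece that contains `x`; `L` bounds the value at
      -- the left end `a` of the current piece. The breakpoint `t ∸ X` is the right end of piece `q`
      -- and the left end of piece `t`. The single option in `bestUsing` that keeps the old `q`
      -- bounds both, as `t` would only restrict the later blocks further.
      pieces : ∀ ts q a x L → Sorted ts → Covered q ts → a ≤ x → x ≤ s → q ≤ a + X → pieceBest q a ≤ L →
        ∃ λ q′ → q′ ≤ x + X × pieceBest q′ x ≤ L ⊔ bestUsing s d is q b X ts
      pieces [] q a x L _ cov a≤x x≤s q≤ le = q , ≤-trans q≤ (+-monoˡ-≤ X a≤x) ,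
        ≤-trans (endpoints (pieceBest-convex q) a≤x x≤s)
          (⊔-mono-≤ le (best-mono is ≤-refl (⊔ᶠ-monoʳ b last) (≤-reflexive (+-comm X s))))
        where
        last : piece q s ≼ completed s d X
        last {k} m with q <ᵇ k in eq | s <ᵇ k in eq′
        ... | true  | true  = ≤-refl
        ... | false | false = ≤-refl
        ... | false | true  = *-monoʳ-≤ d (≤-trans (∸-monoˡ-≤ X (≤-trans (≮⇒≥ λ lt → subst T eq (<⇒<ᵇ lt)) q≤))
                                (≤-trans (≤-reflexive (m+n∸n≡m a X)) (≤-trans a≤x x≤s)))
        ... | true  | false with cov m
        ...   | inj₁ k≤q = contradiction k≤q (<⇒≱ (<ᵇ⇒< q k (subst T (sym eq) tt)))
        ...   | inj₂ (inj₁ s<k) = ⊥-elim (subst T eq′ (<⇒<ᵇ s<k))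
      pieces ((t , p) ∷ ts) q a x L sorted@(_ ∷ sorted′) cov a≤x x≤s q≤ le
        with q <ᵇ t in eq | t <ᵇ suc s in eq′
      ... | true | true with ≤-total x (t ∸ X)
      ...   | inj₁ x≤u = q , ≤-trans q≤ (+-monoˡ-≤ X a≤x) ,
        ≤-trans (endpoints (pieceBest-convex q) a≤x x≤u)
          (⊔-mono-≤ le (≤-trans
            (best-mono is ≤-refl (⊔ᶠ-monoʳ b (piece-right q t ts sorted cov (<⇒≤ q<t) t≤s)) (t≤[t∸X]+X t))
            (m≤m⊔n _ _)))
        where
        q<t : q < t
        q<t = <ᵇ⇒< q t (subst T (sym eq) tt)
        t≤s : t ≤ s
        t≤s = s≤s⁻¹ (<ᵇ⇒< t (suc s) (subst T (sym eq′) tt))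
      ...   | inj₂ u≤x with pieces ts t (t ∸ X) x _ sorted′ cov′ u≤x x≤s (t≤[t∸X]+X t) ≤-refl
        where
        q<t : q < t
        q<t = <ᵇ⇒< q t (subst T (sym eq) tt)
        cov′ : Covered t ts
        cov′ m with cov m
        ... | inj₁ k≤q = inj₁ (≤-trans k≤q (<⇒≤ q<t))
        ... | inj₂ (inj₁ s<k) = inj₂ (inj₁ s<k)
        ... | inj₂ (inj₂ (here refl)) = inj₁ ≤-refl
        ... | inj₂ (inj₂ (there k∈)) = inj₂ (inj₂ k∈)
      ...     | q′ , q′≤ , le′ = q′ , q′≤ , ≤-trans le′ (≤-trans (⊔-monoˡ-≤ _
        (best-mono is (<⇒≤ (<ᵇ⇒< q t (subst T (sym eq) tt)))
          (⊔ᶠ-monoʳ b (λ {k} _ → piece-left t k)) (t≤[t∸X]+X t))) (m≤n⊔m L _))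
      pieces ((t , p) ∷ ts) q a x L (_ ∷ sorted′) cov a≤x x≤s q≤ le | false | _ =
        pieces ts q a x L sorted′ cov′ a≤x x≤s q≤ le
        where
        cov′ : Covered q ts
        cov′ m with cov m
        ... | inj₁ k≤q = inj₁ k≤q
        ... | inj₂ (inj₁ s<k) = inj₂ (inj₁ s<k)
        ... | inj₂ (inj₂ (here refl)) = inj₁ (≮⇒≥ λ lt → subst T eq (<⇒<ᵇ lt))
        ... | inj₂ (inj₂ (there k∈)) = inj₂ (inj₂ k∈)
      pieces ((t , p) ∷ ts) q a x L (_ ∷ sorted′) cov a≤x x≤s q≤ le | true | false =
        pieces ts q a x L sorted′ cov′ a≤x x≤s q≤ le
        where
        cov′ : Covered q ts
        cov′ m with cov m
        ... | inj₁ k≤q = inj₁ k≤q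
        ... | inj₂ (inj₁ s<k) = inj₂ (inj₁ s<k)
        ... | inj₂ (inj₂ (here refl)) = inj₂ (inj₁ (≰⇒> λ t≤s → subst T eq′ (<⇒<ᵇ (s≤s t≤s))))
        ... | inj₂ (inj₂ (there k∈)) = inj₂ (inj₂ k∈)

      -- The sweep starts at `x = 0`, where the block pays nothing because `k ∸ X` vanishes for
      -- `k ≤ q ≤ X`; this is the option of skipping the block. The bound on `q′` restores the
      -- hypothesis `q ≤ X` for the next block.
      best-interrupted : ∀ {q x} → Sorted Ts → x ≤ s → q ≤ X →
        ∃ λ q′ → q′ ≤ x + X × best is q′ (b ⊔ᶠ interrupted x) (x + X) ≤ best ((s , d) ∷ is) q b X
      best-interrupted {q} {x} sorted x≤s q≤X
        with pieces Ts q 0 x (best is q b X) sorted (λ m → inj₂ (inj₂ m)) z≤n x≤s q≤X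
               (best-mono is ≤-refl (λ {k} _ → ⊔-lub ≤-refl (initial k)) ≤-refl)
        where
        initial : ∀ k → piece q 0 k ≤ b k
        initial k with q <ᵇ k in eq
        ... | true  = ≤-trans (≤-reflexive (*-zeroʳ d)) z≤n
        ... | false = ≤-trans (≤-reflexive (trans (cong (d *_) (m≤n⇒m∸n≡0
                        (≤-trans (≮⇒≥ λ lt → subst T eq (<⇒<ᵇ lt)) q≤X))) (*-zeroʳ d))) z≤n
      ... | q′ , q′≤ , le = q′ , q′≤ ,
        ≤-trans (best-mono is ≤-refl (⊔ᶠ-monoʳ b (λ {k} _ → interrupted≤piece q′ x k)) ≤-refl) le

    -- Branch and bound.

    -- The relaxation in which every remaining block may start after l elements.
    upper : List (ℕ × ℕ) → ℕ → ℕ → ℕ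
    upper []             l k = 0
    upper ((s , d) ∷ is) l k = completed s d l k ⊔′ upper is l k

    stopped≤completed : ∀ s d {l t X} → t ≤ s → l ≤ X → ∀ k → stopped d t X k ≤ completed s d l k
    stopped≤completed s d {l} {t} {X} t≤s l≤X k with s <ᵇ k
    ... | true  = *-monoʳ-≤ d (≤-trans (m∸n≤m (k ⊓′ t) X) (≤-trans (m⊓′n≤n k t) t≤s))
    ... | false = *-monoʳ-≤ d (∸-mono (m⊓′n≤m k t) l≤X)

    -- Abandoning a block at `t` resets the position to `t`, which may lie below the old `X` but
    -- never below `q`. Therefore `l` has to bound both.
    best≤upper : ∀ is {l q b X} → l ≤ q → l ≤ X → best is q b X ≤ total Ts (b ⊔ᶠ upper is l)
    bestUsing≤upper : ∀ s d is ts {l q b X} → l ≤ q → l ≤ X →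
      bestUsing s d is q b X ts ≤ total Ts (b ⊔ᶠ upper ((s , d) ∷ is) l)
    best≤upper [] {b = b} l≤q l≤X = total-mono (λ {k} _ → m≤m⊔n (b k) 0)
    best≤upper ((s , d) ∷ is) {l} {b = b} l≤q l≤X = ⊔-lub
      (≤-trans (best≤upper is l≤q l≤X)
        (total-mono (⊔ᶠ-monoʳ b (λ {k} _ → m≤n⊔′m (upper is l k) (completed s d l k)))))
      (bestUsing≤upper s d is Ts l≤q l≤X)
    bestUsing≤upper s d is [] {l} {b = b} {X} l≤q l≤X =
      ≤-trans (best≤upper is {l} l≤q (≤-trans l≤X (m≤m+n X s))) (total-mono bound)
      where
      bound : b ⊔ᶠ completed s d X ⊔ᶠ upper is l ≼ b ⊔ᶠ upper ((s , d) ∷ is) l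
      bound {k} _ = ≤-trans (≤-reflexive (⊔-assoc (b k) _ _)) (⊔-monoʳ-≤ (b k)
        (⊔-lub (≤-trans (completed-anti s d l≤X k) (m≤m⊔′n (completed s d l k) (upper is l k))) (m≤n⊔′m (upper is l k) (completed s d l k))))
    bestUsing≤upper s d is ((t , _) ∷ ts) {l} {q} {b} {X} l≤q l≤X
      with q <ᵇ t in eq | t <ᵇ suc s in eq′
    ... | true | true = ⊔-lub
      (≤-trans (best≤upper is {l} l≤q (≤-trans l≤q (<⇒≤ q<t))) (total-mono bound))
      (bestUsing≤upper s d is ts (≤-trans l≤q (<⇒≤ q<t)) l≤X)
      where
      q<t : q < t
      q<t = <ᵇ⇒< q t (subst T (sym eq) tt)
      bound : b ⊔ᶠ stopped d t X ⊔ᶠ upper is l ≼ b ⊔ᶠ upper ((s , d) ∷ is) l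
      bound {k} _ = ≤-trans (≤-reflexive (⊔-assoc (b k) _ _)) (⊔-monoʳ-≤ (b k)
        (⊔-lub (≤-trans (stopped≤completed s d (s≤s⁻¹ (<ᵇ⇒< t (suc s) (subst T (sym eq′) tt))) l≤X k) (m≤m⊔′n (completed s d l k) (upper is l k)))
               (m≤n⊔′m (upper is l k) (completed s d l k))))
    ... | false | _     = bestUsing≤upper s d is ts l≤q l≤X
    ... | true  | false = bestUsing≤upper s d is ts l≤q l≤X

    Row : Set
    Row = ℕ × ℕ × ℕ

    -- Tabulating the payoffs lets the search compute with numerals instead of ever longer chains of
    -- closures.
    rows : (ℕ → ℕ) → List Row
    rows b = map (λ (k , p) → k , p , b k) Ts

    raise : (ℕ → ℕ) → List Row → List Row
    raise g = map (λ (k , p , v) → k , p , v ⊔′ g k)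

    weigh : List Row → ℕ
    weigh []                 = 0
    weigh ((k , p , v) ∷ rs) = p * v + weigh rs

    raise-rows : ∀ g b → raise g (rows b) ≡ rows (b ⊔ᶠ g)
    raise-rows g b = trans (sym (map-∘ Ts)) (map-cong (λ (k , p) → cong (λ v → k , p , v) (sym (⊔≡⊔′ (b k) (g k)))) Ts)

    weigh-rows : ∀ b → weigh (rows b) ≡ total Ts b
    weigh-rows b = go Ts
      where
      go : ∀ ts → weigh (map (λ (k , p) → k , p , b k) ts) ≡ total ts b
      go []             = refl
      go ((k , p) ∷ ts) = cong (p * b k +_) (go ts)

    check : ℕ → List (ℕ × ℕ) → ℕ → List Row → ℕ → Bool
    checkUsing : ℕ → ℕ → ℕ → List (ℕ × ℕ) → ℕ → List Row → ℕ → List (ℕ × ℕ) → Bool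
    check V []             q r X = weigh r ≤ᵇ V
    check V ((s , d) ∷ is) q r X =
      -- `q ⊓′ X` is the largest start that `best≤upper` admits, hence the sharpest relaxation.
      if weigh (raise (upper ((s , d) ∷ is) (q ⊓′ X)) r) ≤ᵇ V then true
      else (check V is q r X ∧ checkUsing V s d is q r X Ts)
    checkUsing V s d is q r X []             = check V is q (raise (completed s d X) r) (X + s)
    -- Abandoning a block at time X contributes nothing, as does skipping it.
    checkUsing V s d is q r X ((t , _) ∷ ts) = if (q <ᵇ t) ∧ (t <ᵇ suc s)
      then ((if X ≡ᵇ t then true else check V is q (raise (stopped d t X) r) t) ∧ checkUsing V s d is t r X ts)
      else checkUsing V s d is q r X ts

    check-sound : ∀ {V} is {q b X} → T (check V is q (rows b) X) → best is q b X ≤ V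
    checkUsing-sound : ∀ {V} s d is ts {q b X} → best is q b X ≤ V →
      T (checkUsing V s d is q (rows b) X ts) → bestUsing s d is q b X ts ≤ V
    check-sound {V} [] {b = b} ok = subst (_≤ V) (weigh-rows b) (≤ᵇ⇒≤ _ V ok)
    check-sound {V} ((s , d) ∷ is) {q} {b} {X} ok
      with weigh (raise (upper ((s , d) ∷ is) (q ⊓′ X)) (rows b)) ≤ᵇ V in eq
    ... | true = ≤-trans (best≤upper ((s , d) ∷ is) (m⊓′n≤m q X) (m⊓′n≤n q X))
      (subst (_≤ V) (trans (cong weigh (raise-rows (upper ((s , d) ∷ is) (q ⊓′ X)) b))
                           (weigh-rows (b ⊔ᶠ upper ((s , d) ∷ is) (q ⊓′ X))))
        (≤ᵇ⇒≤ _ V (subst T (sym eq) tt)))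
    ... | false with Equivalence.to T-∧ ok
    ...   | ok₁ , ok₂ = ⊔-lub (check-sound is ok₁) (checkUsing-sound s d is Ts (check-sound is ok₁) ok₂)
    checkUsing-sound {V} s d is [] {b = b} {X} _ ok =
      check-sound is (subst (λ r → T (check V is _ r _)) (raise-rows (completed s d X) b) ok)
    checkUsing-sound {V} s d is ((t , _) ∷ ts) {q} {b} {X} skip ok with (q <ᵇ t) in eq | t <ᵇ suc s
    ... | false | _     = checkUsing-sound s d is ts skip ok
    ... | true  | false = checkUsing-sound s d is ts skip ok
    ... | true  | true with Equivalence.to (T-∧ {if X ≡ᵇ t then true else _}) ok
    ...   | ok₁ , ok₂ = ⊔-lub stop (checkUsing-sound s d is ts
      (≤-trans (best-mono is (<⇒≤ (<ᵇ⇒< q t (subst T (sym eq) tt))) (λ _ → ≤-refl) ≤-refl) skip) ok₂)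
      where
      stop : best is q (b ⊔ᶠ stopped d t X) t ≤ V
      stop with X ≡ᵇ t in eq′
      ... | false = check-sound is (subst (λ r → T (check V is _ r _)) (raise-rows (stopped d t X) b) ok₁)
      ... | true  = ≤-trans (best-mono is ≤-refl idle (≤-reflexive X≡t)) skip
        where
        X≡t : X ≡ t
        X≡t = ≡ᵇ⇒≡ X t (subst T (sym eq′) tt)
        idle : b ⊔ᶠ stopped d t X ≼ b
        idle {k} _ = ⊔-lub ≤-refl (≤-trans (≤-reflexive (trans
          (cong (d *_) (m≤n⇒m∸n≡0 (≤-trans (m⊓′n≤n k t) (≤-reflexive (sym X≡t))))) (*-zeroʳ d))) z≤n)

  -- From element counts along an order to schedules.

  latest : ∀ {P : ℕ → Set} → (∀ k → Dec (P k)) → (ts : List (ℕ × ℕ)) →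
    (∀ {k p} → (k , p) ∈ ts → ¬ P k) ⊎
    (∃ λ e → P e × ∀ {k p} → (k , p) ∈ ts → P k → k ≤ e)
  latest P? [] = inj₁ λ ()
  latest P? ((t , _) ∷ ts) with latest P? ts | P? t
  ... | inj₁ none | no ¬pt = inj₁ λ { (here refl) → ¬pt ; (there m) → none m }
  ... | inj₁ none | yes pt = inj₂ (t , pt , λ { (here refl) _ → ≤-refl ; (there m) pk → contradiction pk (none m) })
  ... | inj₂ (e , pe , max) | no ¬pt = inj₂ (e , pe , λ { (here refl) pk → contradiction pk ¬pt ; (there m) → max m })
  ... | inj₂ (e , pe , max) | yes pt with ≤-total t e
  ...   | inj₁ t≤e = inj₂ (e , pe , λ { (here refl) _ → t≤e ; (there m) → max m })
  ...   | inj₂ e≤t = inj₂ (t , pt , λ { (here refl) _ → ≤-refl ; (there m) pk → ≤-trans (max m pk) e≤t })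

  peak : List (ℕ × ℕ) → ℕ → (ℕ → ℕ) → ℕ
  peak []             i c = 0
  peak ((s , d) ∷ is) i c = d * (s ⊓ c i) ⊔ peak is (suc i) c

  peak′ : List (ℕ × ℕ) → ℕ → (ℕ → ℕ) → ℕ
  peak′ []             i c = 0
  peak′ ((s , d) ∷ is) i c = d * (s ⊓′ c i) ⊔′ peak′ is (suc i) c

  peak≡peak′ : ∀ is i c → peak is i c ≡ peak′ is i c
  peak≡peak′ []             i c = refl
  peak≡peak′ ((s , d) ∷ is) i c =
    trans (cong₂ (λ x y → d * x ⊔ y) (⊓≡⊓′ s (c i)) (peak≡peak′ is (suc i) c)) (⊔≡⊔′ (d * (s ⊓′ c i)) _)

  peak-mono : ∀ is i {c c′} → (∀ j → c j ≤ c′ j) → peak is i c ≤ peak is i c′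
  peak-mono []             i le = z≤n
  peak-mono ((s , d) ∷ is) i le = ⊔-mono-≤ (*-monoʳ-≤ d (⊓-monoʳ-≤ s (le i))) (peak-mono is (suc i) le)

  peak-≤ : ∀ is i {c d y} → All (λ (_ , d′) → d′ ≤ d) is → (∀ j → i ≤ j → c j ≤ y) → peak is i c ≤ d * y
  peak-≤ []              i []          le = z≤n
  peak-≤ ((s , d′) ∷ is) i (d′≤d ∷ ds) le = ⊔-lub
    (*-mono-≤ d′≤d (≤-trans (m⊓n≤n s _) (le i ≤-refl)))
    (peak-≤ is (suc i) ds λ j i<j → le j (<⇒≤ i<j))

  Denser : List (ℕ × ℕ) → Set
  Denser = AllPairs (λ (_ , d) (_ , d′) → d′ ≤ d)

  -- c i k and C i k stand for the number of elements of block i, respectively of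
  -- the blocks before i, among the first k elements of the order.
  module _ (Ts : List (ℕ × ℕ)) (sorted : AllPairs (λ t u → proj₁ t ≤ proj₁ u) Ts)
           (c C : ℕ → ℕ → ℕ)
           (c-mono : ∀ i {k l} → k ≤ l → c i k ≤ c i l)
           (C-mono : ∀ i {k l} → k ≤ l → C i k ≤ C i l)
           (C+c≤C : ∀ i k → C i k + c i k ≤ C (suc i) k)
           (C≤k : ∀ i k → C i k ≤ k)
    where

    C-monoˡ : ∀ {i j} k → i ≤ j → C i k ≤ C j k
    C-monoˡ {i} k i≤j = go (≤⇒≤′ i≤j)
      where
      go : ∀ {j} → i ≤′ j → C i k ≤ C j k
      go ≤′-refl         = ≤-refl
      go (≤′-step {j} p) = ≤-trans (go p) (≤-trans (m≤m+n _ _) (C+c≤C j k))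

    C+c≤k : ∀ {i j} k → i ≤ j → C i k + c j k ≤ k
    C+c≤k {i} {j} k i≤j = ≤-trans (+-monoˡ-≤ _ (C-monoˡ k i≤j)) (≤-trans (C+c≤C j k) (C≤k (suc j) k))

    -- The times up to θ are already paid for by b; after θ only the blocks from i
    -- on attain the maximum.
    total≤best : ∀ (M : ℕ → ℕ) → (∀ {k l} → k ≤ l → M k ≤ M l) → ∀ is i θ {q b X} → Denser is → q ≤ X → X ≤ C i θ →
      (∀ {k p} → (k , p) ∈ Ts → k ≤ θ → M k ≤ b k) →
      (∀ {k p} → (k , p) ∈ Ts → θ < k → M k ≤ peak is i (λ j → c j k)) →
      total Ts M ≤ best Ts is q b X
    total≤best M M-mono [] i θ {b = b} _ _ _ early late = total-mono Ts le
      where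
      le : ∀ {k p} → (k , p) ∈ Ts → M k ≤ b k
      le {k} m with k ≤? θ
      ... | yes k≤θ = early m k≤θ
      ... | no  k≰θ = ≤-trans (late m (≰⇒> k≰θ)) z≤n
    total≤best M M-mono ((s , d) ∷ is) i θ {q} {b} {X} (d≥ ∷ ds) q≤X X≤C early late
      with latest {λ k → θ < k × M k ≤ d * (s ⊓ c i k)} (λ k → θ <? k ×-dec M k ≤? d * (s ⊓ c i k)) Ts
    ... | inj₁ none = ≤-trans
      (total≤best M M-mono is (suc i) θ ds q≤X (≤-trans X≤C (C-monoˡ θ (n≤1+n i))) early late′)
      (m≤m⊔n _ _)
      where
      late′ : ∀ {k p} → (k , p) ∈ Ts → θ < k → M k ≤ peak is (suc i) (λ j → c j k)
      late′ {k} m θ<k with ⊔-sel (d * (s ⊓ c i k)) (peak is (suc i) (λ j → c j k))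
      ... | inj₁ eq = contradiction (θ<k , subst (M k ≤_) eq (late m θ<k)) (none m)
      ... | inj₂ eq = subst (M k ≤_) eq (late m θ<k)
    ... | inj₂ (e , (θ<e , Me≤) , last)
      with best-interrupted Ts s d is b X {x = s ⊓ c i e} sorted (m⊓n≤m s _) q≤X
    ...   | q′ , q′≤ , le = ≤-trans
      (total≤best M M-mono is (suc i) e ds q′≤ x+X≤C early′ late′) le
      where
      -- Elements of block `i` beyond the first `s` are worthless and are not charged to the
      -- elements spent; this is why `X` is only bounded by `C i θ`.
      x = s ⊓ c i e
      x+X≤C : x + X ≤ C (suc i) e
      x+X≤C = ≤-trans (≤-reflexive (+-comm x X))
        (≤-trans (+-mono-≤ (≤-trans X≤C (C-mono i (<⇒≤ θ<e))) (m⊓n≤n s _)) (C+c≤C i e))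
      early′ : ∀ {k p} → (k , p) ∈ Ts → k ≤ e → M k ≤ b k ⊔ d * (x ⊓ (k ∸ X))
      early′ {k} m k≤e with k ≤? θ
      ... | yes k≤θ = ≤-trans (early m k≤θ) (m≤m⊔n _ _)
      -- Between `θ` and `e` two bounds meet: `M k ≤ M e ≤ d * x` by monotonicity, and `rate`.
      ... | no  k≰θ = ≤-trans (subst (M k ≤_) (sym (*-distribˡ-⊓ d x (k ∸ X)))
                        (⊓-glb (≤-trans (M-mono k≤e) Me≤) rate)) (m≤n⊔m (b k) _)
        where
        -- All blocks from `i` on have density at most `d`, and their elements are disjoint from the
        -- at least `X` elements of earlier blocks among the first `k`.
        rate : M k ≤ d * (k ∸ X)
        rate = ≤-trans (late m (≰⇒> k≰θ)) (peak-≤ ((s , d) ∷ is) i (≤-refl ∷ d≥) λ j i≤j →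
          m+n≤o⇒m≤o∸n (c j k) (≤-trans (≤-reflexive (+-comm (c j k) X))
            (≤-trans (+-monoˡ-≤ _ (≤-trans X≤C (C-mono i (<⇒≤ (≰⇒> k≰θ))))) (C+c≤k k i≤j))))
      late′ : ∀ {k p} → (k , p) ∈ Ts → e < k → M k ≤ peak is (suc i) (λ j → c j k)
      late′ {k} m e<k with ⊔-sel (d * (s ⊓ c i k)) (peak is (suc i) (λ j → c j k))
      ... | inj₁ eq = contradiction (last m (<-trans θ<e e<k , subst (M k ≤_) eq (late m (<-trans θ<e e<k)))) (<⇒≱ e<k)
      ... | inj₂ eq = subst (M k ≤_) eq (late m (<-trans θ<e e<k))

-- Cardinalities of Boolean predicates, and the block objective in `ℕ`.

module Counting where

  open Schedules
  open import Data.Bool using (Bool; true; false; if_then_else_; _∧_; not; T)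
  open import Data.Bool.Properties using (T-∧; T-irrelevant)
  open import Data.Empty using (⊥-elim)
  open import Data.Fin as Fin using (Fin; zero; suc; toℕ; fromℕ<; inject≤; combine; remQuot)
  import Data.Fin.Properties as Finₚ
  open import Data.Fin.Permutation using (↔⇒≡)
  open import Data.List using (List; []; _∷_; length)
  open import Data.Nat
  open import Data.Nat.Properties
  open import Data.Product using (Σ; ∃; _×_; _,_; proj₁; proj₂)
  open import Data.Sum using (_⊎_; inj₁; inj₂; [_,_]′)
  open import Data.Unit using (tt)
  open import Data.Vec as Vec using (Vec; tabulate)
  open import Data.Vec.Membership.Propositional using (_∈_)
  open import Data.Vec.Relation.Unary.Any using (index)
  open import Data.Vec.Relation.Unary.Any.Properties using (lookup-index)
  open import Data.Vec.Properties using (lookup∘tabulate)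
  open import Data.List.Relation.Unary.AllPairs using (AllPairs)
  open import Algebra.Properties.CommutativeSemigroup +-commutativeSemigroup using (interchange)
  open import Algebra.Properties.CommutativeSemigroup *-commutativeSemigroup using (x∙yz≈z∙yx)
  open import Function using (_∘_; Equivalence; Inverse; Injection; _↔_; mk↔ₛ′)
  open import Function.Properties.Inverse using (↔-refl; ↔-sym; ↔-trans; ↔⇒↣)
  open import Data.Sum.Function.Propositional using (_⊎-↔_)
  open import Relation.Binary.PropositionalEquality
  open import Relation.Nullary using (¬_; does; yes; no; contradiction)

  T-not : ∀ {b} → T (not b) → ¬ T b
  T-not {false} _ ()

  indicator : Bool → ℕ
  indicator b = if b then 1 else 0

  count : ∀ {n} → (Fin n → Bool) → ℕ
  count {zero}  p = 0
  count {suc n} p = indicator (p zero) + count (p ∘ suc)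

  T⇒1≤indicator : ∀ {b} → T b → 1 ≤ indicator b
  T⇒1≤indicator {true} _ = ≤-refl

  indicator-≤ : ∀ {a b c} → (T a → T b ⊎ T c) → indicator a ≤ indicator b + indicator c
  indicator-≤ {false} h = z≤n
  indicator-≤ {true} {b} {c} h with h tt
  ... | inj₁ tb = ≤-trans (T⇒1≤indicator tb) (m≤m+n _ _)
  ... | inj₂ tc = ≤-trans (T⇒1≤indicator tc) (m≤n+m _ _)

  count-≤-+ : ∀ {n} (r p q : Fin n → Bool) → (∀ u → T (r u) → T (p u) ⊎ T (q u)) → count r ≤ count p + count q
  count-≤-+ {zero}  r p q h = z≤n
  count-≤-+ {suc n} r p q h = ≤-trans
    (+-mono-≤ (indicator-≤ (h zero)) (count-≤-+ (r ∘ suc) (p ∘ suc) (q ∘ suc) (h ∘ suc)))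
    (≤-reflexive (interchange (indicator (p zero)) _ _ _))

  count-none : ∀ {n} (p : Fin n → Bool) → (∀ u → ¬ T (p u)) → count p ≡ 0
  count-none {zero}  p h = refl
  count-none {suc n} p h with p zero in eq
  ... | true  = ⊥-elim (h zero (subst T (sym eq) tt))
  ... | false = count-none (p ∘ suc) (h ∘ suc)

  count-mono : ∀ {n} (p q : Fin n → Bool) → (∀ u → T (p u) → T (q u)) → count p ≤ count q
  count-mono {n} p q h = subst (count p ≤_)
    (trans (cong (count q +_) (count-none {n} (λ _ → false) λ _ ())) (+-identityʳ _))
    (count-≤-+ p q (λ _ → false) (λ u → inj₁ ∘ h u))

  count-one : ∀ {n} (p : Fin n → Bool) → (∀ u v → T (p u) → T (p v) → u ≡ v) → count p ≤ 1
  count-one {zero}  p h = z≤n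
  count-one {suc n} p h with p zero in eq
  ... | false = count-one (p ∘ suc) λ u v pu pv → Finₚ.suc-injective (h (suc u) (suc v) pu pv)
  ... | true  = ≤-reflexive (cong suc (count-none (p ∘ suc) λ u pu → Finₚ.0≢1+n (h zero (suc u) (subst T (sym eq) tt) pu)))

  count-disjoint : ∀ {n} (p q r : Fin n → Bool) → (∀ u → T (p u) → T (r u)) → (∀ u → T (q u) → T (r u)) →
    (∀ u → T (p u) → ¬ T (q u)) → count p + count q ≤ count r
  count-disjoint {zero}  p q r p⊆r q⊆r p∩q = z≤n
  count-disjoint {suc n} p q r p⊆r q⊆r p∩q = ≤-trans
    (≤-reflexive (interchange (indicator (p zero)) _ _ _))
    (+-mono-≤ (head (p⊆r zero) (q⊆r zero) (p∩q zero)) (count-disjoint (p ∘ suc) (q ∘ suc) (r ∘ suc) (p⊆r ∘ suc) (q⊆r ∘ suc) (p∩q ∘ suc)))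
    where
    head : ∀ {a b c} → (T a → T c) → (T b → T c) → (T a → ¬ T b) → indicator a + indicator b ≤ indicator c
    head {false} {false} _  _  _  = z≤n
    head {false} {true}  _  bc _  = T⇒1≤indicator (bc tt)
    head {true}  {false} ac _  _  = T⇒1≤indicator (ac tt)
    head {true}  {true}  _  _  ab = contradiction tt (ab tt)

  count-< : ∀ {n} k → count (λ (j : Fin n) → toℕ j <ᵇ k) ≤ k
  count-< {zero}  k       = z≤n
  count-< {suc n} zero    = ≤-reflexive (count-none {n} (λ _ → false) λ _ ())
  count-< {suc n} (suc k) = s≤s (count-< {n} k)

  count≤n : ∀ {n} (p : Fin n → Bool) → count p ≤ n
  count≤n {zero}  p = z≤n
  count≤n {suc n} p with p zero
  ... | true  = s≤s (count≤n (p ∘ suc))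
  ... | false = m≤n⇒m≤1+n (count≤n (p ∘ suc))

  enumerate : ∀ {n} (p : Fin n → Bool) → Fin (count p) ↔ Σ (Fin n) (T ∘ p)
  enumerate {zero}  p = mk↔ₛ′ (λ ()) (λ ()) (λ ()) (λ ())
  enumerate {suc n} p = ↔-trans (uncons (p zero)) (↔-trans (↔-refl ⊎-↔ enumerate (p ∘ suc)) merge)
    where
    uncons : ∀ b {c} → Fin (indicator b + c) ↔ (T b ⊎ Fin c)
    uncons true  = mk↔ₛ′ (λ { zero → inj₁ tt ; (suc i) → inj₂ i }) (λ { (inj₁ _) → zero ; (inj₂ i) → suc i })
      (λ { (inj₁ _) → refl ; (inj₂ i) → refl }) (λ { zero → refl ; (suc i) → refl })
    uncons false = mk↔ₛ′ inj₂ (λ { (inj₁ ()) ; (inj₂ i) → i }) (λ { (inj₁ ()) ; (inj₂ i) → refl }) (λ i → refl)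

    merge : (T (p zero) ⊎ Σ (Fin n) (T ∘ p ∘ suc)) ↔ Σ (Fin (suc n)) (T ∘ p)
    merge = mk↔ₛ′ (λ { (inj₁ t) → zero , t ; (inj₂ (u , t)) → suc u , t })
      (λ { (zero , t) → inj₁ t ; (suc u , t) → inj₂ (u , t) })
      (λ { (zero , t) → refl ; (suc u , t) → refl }) (λ { (inj₁ t) → refl ; (inj₂ (u , t)) → refl })

  -- Choosing a preimage for each element of `q` is injective, since `g` recovers the element.
  count-image : ∀ {n m} (g : Fin n → Fin m) (p : Fin n → Bool) (q : Fin m → Bool) →
    (∀ u → T (q u) → ∃ λ j → T (p j) × g j ≡ u) → count q ≤ count p
  count-image {n} {m} g p q h = Finₚ.injective⇒≤ {f = f} f-injective
    where
    open Inverse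
    preimage : Fin (count q) → Σ (Fin n) (T ∘ p)
    preimage i = let u , qu = to (enumerate q) i in let j , pj , _ = h u qu in j , pj
    g-preimage : ∀ i → g (proj₁ (preimage i)) ≡ proj₁ (to (enumerate q) i)
    g-preimage i = proj₂ (proj₂ (h _ (proj₂ (to (enumerate q) i))))
    f : Fin (count q) → Fin (count p)
    f i = from (enumerate p) (preimage i)
    Σ-≡ : ∀ {x y : Σ (Fin m) (T ∘ q)} → proj₁ x ≡ proj₁ y → x ≡ y
    Σ-≡ refl = cong (_ ,_) (T-irrelevant _ _)
    f-injective : ∀ {i i′} → f i ≡ f i′ → i ≡ i′
    f-injective {i} {i′} eq = Injection.injective (↔⇒↣ (enumerate q)) (Σ-≡ (trans (sym (g-preimage i))
      (trans (cong (g ∘ proj₁) (Injection.injective (↔⇒↣ (↔-sym (enumerate p))) eq)) (g-preimage i′))))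

  prepend : ∀ {n} → Bool → (Fin n → Bool) → Fin (suc n) → Bool
  prepend b p zero    = b
  prepend b p (suc u) = p u

  -- Recursion on whether the first element is chosen. The hypothesis on `g` stands in for function
  -- extensionality, as `prepend` rebuilds a set only pointwise.
  largest : ∀ n k → k ≤ n → (g : (Fin n → Bool) → ℕ) → (∀ {p q} → (∀ u → p u ≡ q u) → g p ≡ g q) →
    ∃ λ p → count p ≡ k × ∀ q → count q ≡ k → g q ≤ g p
  largest zero zero _ g ext = (λ ()) , refl , λ q _ → ≤-reflexive (ext λ ())
  largest (suc n) zero _ g ext = prepend false p , |p| , λ q |q| → optimal q |q|
    where
    rec = largest n 0 z≤n (g ∘ prepend false) (λ eq → ext λ { zero → refl ; (suc u) → eq u })
    p = proj₁ rec
    |p| = proj₁ (proj₂ rec)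
    optimal : ∀ q → count q ≡ 0 → g q ≤ g (prepend false p)
    optimal q |q| with q zero in eq
    ... | false = ≤-trans (≤-reflexive (ext λ { zero → eq ; (suc u) → refl })) (proj₂ (proj₂ rec) (q ∘ suc) |q|)
  largest (suc n) (suc k) (s≤s k≤n) g ext with suc k ≤? n
  ... | no k≰n = prepend true p , cong suc |p| , optimal
    where
    rec = largest n k k≤n (g ∘ prepend true) (λ eq → ext λ { zero → refl ; (suc u) → eq u })
    p = proj₁ rec
    |p| = proj₁ (proj₂ rec)
    optimal : ∀ q → count q ≡ suc k → g q ≤ g (prepend true p)
    optimal q |q| with q zero in eq
    ... | true  = ≤-trans (≤-reflexive (ext λ { zero → eq ; (suc u) → refl })) (proj₂ (proj₂ rec) (q ∘ suc) (suc-injective |q|))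
    ... | false = contradiction (subst (_≤ n) |q| (count≤n (q ∘ suc))) k≰n
  ... | yes k<n = pick (≤-total (g (prepend true p)) (g (prepend false p′)))
    where
    rec  = largest n k k≤n (g ∘ prepend true) (λ eq → ext λ { zero → refl ; (suc u) → eq u })
    rec′ = largest n (suc k) k<n (g ∘ prepend false) (λ eq → ext λ { zero → refl ; (suc u) → eq u })
    p  = proj₁ rec
    p′ = proj₁ rec′
    below : ∀ q → count q ≡ suc k → g q ≤ g (prepend true p) ⊎ g q ≤ g (prepend false p′)
    below q |q| with q zero in eq
    ... | true  = inj₁ (≤-trans (≤-reflexive (ext λ { zero → eq ; (suc u) → refl })) (proj₂ (proj₂ rec) (q ∘ suc) (suc-injective |q|)))
    ... | false = inj₂ (≤-trans (≤-reflexive (ext λ { zero → eq ; (suc u) → refl })) (proj₂ (proj₂ rec′) (q ∘ suc) |q|))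
    pick : g (prepend true p) ≤ g (prepend false p′) ⊎ g (prepend false p′) ≤ g (prepend true p) →
      ∃ λ p → count p ≡ suc k × ∀ q → count q ≡ suc k → g q ≤ g p
    pick (inj₁ le) = prepend false p′ , proj₁ (proj₂ rec′) , λ q |q| → [ (λ h → ≤-trans h le) , (λ h → h) ]′ (below q |q|)
    pick (inj₂ le) = prepend true p , cong suc (proj₁ (proj₂ rec)) , λ q |q| → [ (λ h → h) , (λ h → ≤-trans h le) ]′ (below q |q|)

  -- All blocks have K elements, so that the underlying set is Fin (length S * K);
  -- only s of them count towards the worth of a block of size s.
  module Blocks (S : List (ℕ × ℕ)) (K : ℕ) where

    size : ℕ
    size = length S * K

    row : Fin size → ℕ
    row u = toℕ (proj₁ (remQuot {length S} K u))

    inRow : ℕ → (Fin size → Bool) → Fin size → Bool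
    inRow i X u = X u ∧ (row u ≡ᵇ i)

    worth : (Fin size → Bool) → ℕ
    worth X = peak S 0 (λ i → count (inRow i X))

    T-inRow : ∀ {i X u} → T (X u) → row u ≡ i → T (inRow i X u)
    T-inRow {i} {X} {u} Xu eq = Equivalence.from T-∧ (Xu , ≡⇒≡ᵇ (row u) i eq)

    inRow-T : ∀ {i X u} → T (inRow i X u) → T (X u) × row u ≡ i
    inRow-T {i} {X} {u} h = let Xu , eq = Equivalence.to T-∧ h in Xu , ≡ᵇ⇒≡ (row u) i eq

    inRow-mono : ∀ {i X Y} → (∀ u → T (X u) → T (Y u)) → count (inRow i X) ≤ count (inRow i Y)
    inRow-mono {i} {X} {Y} X⊆Y = count-mono (inRow i X) (inRow i Y) λ u h →
      let Xu , eq = inRow-T {i} {X} h in T-inRow {i} {Y} (X⊆Y u Xu) eq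

    worth-mono : ∀ {X Y} → (∀ u → T (X u) → T (Y u)) → worth X ≤ worth Y
    worth-mono {X} {Y} X⊆Y = peak-mono S 0 (λ i → inRow-mono {i} {X} {Y} X⊆Y)

    _without_ : (Fin size → Bool) → Fin size → Fin size → Bool
    (X without e) u = X u ∧ not (does (u Finₚ.≟ e))

    T-without : ∀ {X e u} → T (X u) → u ≢ e → T ((X without e) u)
    T-without {X} {e} {u} Xu u≢e with u Finₚ.≟ e
    ... | yes u≡e = contradiction u≡e u≢e
    ... | no  _   = Equivalence.from T-∧ (Xu , tt)

    inRow-without-other : ∀ {X e i} → row e ≢ i → count (inRow i X) ≤ count (inRow i (X without e))
    inRow-without-other {X} {e} {i} re≢i = count-mono (inRow i X) (inRow i (X without e)) λ u h →
      let Xu , eq = inRow-T {i} {X} h in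
      T-inRow {i} {X without e} (T-without {X} Xu λ { refl → re≢i eq }) eq

    inRow-without : ∀ {X e i} → count (inRow i X) ≤ suc (count (inRow i (X without e)))
    inRow-without {X} {e} {i} = ≤-trans
      (count-≤-+ (inRow i X) (λ u → does (u Finₚ.≟ e)) (inRow i (X without e)) split)
      (+-monoˡ-≤ _ (count-one _ λ u v → only u v))
      where
      split : ∀ u → T (inRow i X u) → T (does (u Finₚ.≟ e)) ⊎ T (inRow i (X without e) u)
      split u h with u Finₚ.≟ e in eq
      ... | yes _ = inj₁ tt
      ... | no ne = let Xu , r = inRow-T {i} {X} h in inj₂ (Equivalence.from T-∧ (Equivalence.from T-∧ (Xu , tt) , ≡⇒≡ᵇ (row u) i r))
      only : ∀ u v → T (does (u Finₚ.≟ e)) → T (does (v Finₚ.≟ e)) → u ≡ v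
      only u v hu hv with u Finₚ.≟ e | v Finₚ.≟ e
      ... | yes refl | yes refl = refl

    find : ∀ {n} (p : Fin n → Bool) → (∃ λ u → T (p u)) ⊎ (∀ u → ¬ T (p u))
    find {zero}  p = inj₂ λ ()
    find {suc n} p with p zero in eq
    ... | true  = inj₁ (zero , subst T (sym eq) tt)
    ... | false with find (p ∘ suc)
    ...   | inj₁ (u , pu) = inj₁ (suc u , pu)
    ...   | inj₂ none     = inj₂ λ { zero pu → subst T eq pu ; (suc u) pu → none u pu }

    -- The first alternative is the maximum over no blocks: it is 0 and cannot drop. Otherwise one
    -- block carries the value, and its term alone controls the loss after a removal.
    attained : ∀ is i {c} → (∀ {c′} → peak is i c ≤ peak is i c′) ⊎
      ∃ λ j → ∃ λ s → ∃ λ d → peak is i c ≡ d * (s ⊓ c j) × (∀ {c′} → d * (s ⊓ c′ j) ≤ peak is i c′)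
    attained []             i = inj₁ z≤n
    attained ((s , d) ∷ is) i {c} with ⊔-sel (d * (s ⊓ c i)) (peak is (suc i) c)
    ... | inj₁ eq = inj₂ (i , s , d , eq , m≤m⊔n _ _)
    ... | inj₂ eq with attained is (suc i) {c}
    ...   | inj₁ le = inj₁ (≤-trans (≤-reflexive eq) (≤-trans le (m≤n⊔m _ _)))
    ...   | inj₂ (j , s′ , d′ , eq′ , le) = inj₂ (j , s′ , d′ , trans eq eq′ , ≤-trans le (m≤n⊔m _ _))

    -- If `s ≤ c′`, the cap `s` absorbs the loss. Otherwise `d * c` bounds the payoff, and a linear
    -- function loses one `c`-th part per element. Multiplying by `c` avoids the division.
    removal : ∀ s d {c c′} → c ≤ suc c′ → c * (d * (s ⊓ c)) ≤ c * (d * (s ⊓ c′)) + d * (s ⊓ c)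
    removal s d {c} {c′} c≤ with ≤-total s c′
    ... | inj₁ s≤c′ = ≤-trans (*-monoʳ-≤ c (*-monoʳ-≤ d (≤-trans (m⊓n≤m s c) (⊓-glb ≤-refl s≤c′)))) (m≤m+n _ _)
    ... | inj₂ c′≤s rewrite m≥n⇒m⊓n≡n c′≤s = begin
      c * (d * (s ⊓ c))            ≤⟨ *-monoˡ-≤ _ c≤ ⟩
      suc c′ * (d * (s ⊓ c))       ≡⟨ +-comm (d * (s ⊓ c)) (c′ * (d * (s ⊓ c))) ⟩
      c′ * (d * (s ⊓ c)) + d * (s ⊓ c) ≤⟨ +-monoˡ-≤ _ (*-monoʳ-≤ c′ (*-monoʳ-≤ d (m⊓n≤n s c))) ⟩
      c′ * (d * c) + d * (s ⊓ c)   ≡⟨ cong (_+ d * (s ⊓ c)) (x∙yz≈z∙yx c′ d c) ⟩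
      c * (d * c′) + d * (s ⊓ c)   ∎
      where open ≤-Reasoning

    -- An element outside the block that attains the maximum can be removed at no cost. If there is
    -- none, `X` lies within that block, so its count there is `n` and `removal` applies.
    accountable : ∀ X n .{{_ : NonZero n}} → count X ≡ n →
      ∃ λ e → T (X e) × n * worth X ≤ n * worth (X without e) + worth X
    accountable X n |X| with attained S 0 {λ i → count (inRow i X)} | find X
    ... | _      | inj₂ none = contradiction (trans (sym |X|) (count-none X none)) (≢-nonZero⁻¹ n)
    ... | inj₁ le | inj₁ (e , Xe) = e , Xe , ≤-trans (*-monoʳ-≤ n le) (m≤m+n _ _)
    ... | inj₂ (j , s , d , eq , le) | inj₁ (e , Xe) with find (λ u → X u ∧ not (row u ≡ᵇ j))
    ...   | inj₁ (o , h) = o , proj₁ Xo , ≤-trans (*-monoʳ-≤ n (≤-trans (≤-reflexive eq)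
        (≤-trans (*-monoʳ-≤ d (⊓-monoʳ-≤ s (inRow-without-other {X} {o} ro≢j))) le))) (m≤m+n _ _)
      where
      Xo = Equivalence.to T-∧ h
      ro≢j : row o ≢ j
      ro≢j ro≡j = T-not (proj₂ Xo) (≡⇒≡ᵇ (row o) j ro≡j)
    ...   | inj₂ none = e , Xe , (begin
        n * worth X ≡⟨ cong₂ _*_ n≡ eq ⟩
        cj * (d * (s ⊓ cj)) ≤⟨ removal s d (inRow-without {X} {e} {j}) ⟩
        cj * (d * (s ⊓ cj′)) + d * (s ⊓ cj) ≤⟨ +-mono-≤ (*-mono-≤ (≤-reflexive (sym n≡)) le) (≤-reflexive (sym eq)) ⟩
        n * worth (X without e) + worth X ∎)
      where
      open ≤-Reasoning
      cj  = count (inRow j X)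
      cj′ = count (inRow j (X without e))
      n≡ : n ≡ cj
      n≡ = trans (sym |X|) (≤-antisym
        (count-mono X (inRow j X) λ u Xu → Equivalence.from T-∧ (Xu , inside u Xu))
        (count-mono (inRow j X) X λ u h → proj₁ (inRow-T {j} {X} h)))
        where
        inside : ∀ u → T (X u) → T (row u ≡ᵇ j)
        inside u Xu with row u ≡ᵇ j | none u
        ... | true  | _ = tt
        ... | false | h = h (Equivalence.from T-∧ (Xu , tt))

    worth-ext : ∀ {X Y} → (∀ u → X u ≡ Y u) → worth X ≡ worth Y
    worth-ext {X} {Y} eq = ≤-antisym
      (worth-mono {X} {Y} λ u → subst T (eq u)) (worth-mono {Y} {X} λ u → subst T (sym (eq u)))

    module _ {k : ℕ} (k≤K : k ≤ K) (i : Fin (length S)) where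

      segment : Fin size → Bool
      segment u = (row u ≡ᵇ toℕ i) ∧ (toℕ (proj₂ (remQuot {length S} K u)) <ᵇ k)

      segment-↔ : Fin k ↔ Σ (Fin size) (T ∘ segment)
      segment-↔ = mk↔ₛ′ to from to-from from-to
        where
        to : Fin k → Σ (Fin size) (T ∘ segment)
        to j = combine i (inject≤ j k≤K) , Equivalence.from T-∧
          ( ≡⇒≡ᵇ (row (combine i (inject≤ j k≤K))) (toℕ i) (cong (toℕ ∘ proj₁) (Finₚ.remQuot-combine i (inject≤ j k≤K)))
          , <⇒<ᵇ (subst (_< k) (sym (trans (cong (toℕ ∘ proj₂) (Finₚ.remQuot-combine i (inject≤ j k≤K)))
              (Finₚ.toℕ-inject≤ j k≤K))) (Finₚ.toℕ<n j)))
        column<k : ∀ u → T (segment u) → toℕ (proj₂ (remQuot {length S} K u)) < k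
        column<k u h = <ᵇ⇒< _ k (proj₂ (Equivalence.to (T-∧ {row u ≡ᵇ toℕ i}) h))
        from : Σ (Fin size) (T ∘ segment) → Fin k
        from (u , h) = fromℕ< (column<k u h)
        pair-≡ : ∀ {u v} {h : T (segment u)} {h′ : T (segment v)} → u ≡ v →
          _≡_ {A = Σ (Fin size) (T ∘ segment)} (u , h) (v , h′)
        pair-≡ refl = cong (_ ,_) (T-irrelevant _ _)
        to-from : ∀ x → to (from x) ≡ x
        to-from (u , h) = pair-≡ (trans (cong₂ combine
            (Finₚ.toℕ-injective (sym (≡ᵇ⇒≡ (row u) (toℕ i) (proj₁ (Equivalence.to T-∧ h)))))
            (Finₚ.toℕ-injective (trans (Finₚ.toℕ-inject≤ _ k≤K) (Finₚ.toℕ-fromℕ< (column<k u h)))))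
          (Finₚ.combine-remQuot {length S} K u))
        from-to : ∀ j → from (to j) ≡ j
        from-to j = Finₚ.toℕ-injective (trans (Finₚ.toℕ-fromℕ< (column<k _ (proj₂ (to j))))
          (trans (cong (toℕ ∘ proj₂) (Finₚ.remQuot-combine i (inject≤ j k≤K))) (Finₚ.toℕ-inject≤ j k≤K)))

    peak-lub : ∀ is i {k o} → (∀ j → i ≤ j → j < i + length is → peak is i (λ l → if l ≡ᵇ j then k else 0) ≤ o) →
      peak is i (λ _ → k) ≤ o
    peak-lub []             i         h = z≤n
    peak-lub ((s , d) ∷ is) i {k} {o} h = ⊔-lub
      (subst (λ b → d * (s ⊓ (if b then k else 0)) ≤ o) (T⇒≡true (≡⇒≡ᵇ i i refl))
        (≤-trans (m≤m⊔n _ _) (h i ≤-refl (m<m+n i (s≤s z≤n)))))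
      (peak-lub is (suc i) λ j i<j j< → ≤-trans (m≤n⊔m _ _)
        (h j (<⇒≤ i<j) (subst (j <_) (sym (+-suc i (length is))) j<)))
      where
      T⇒≡true : ∀ {b} → T b → b ≡ true
      T⇒≡true {true} _ = refl

    hasCard⇒count : ∀ {X : Fin size → Bool} {k} → Fin k ↔ Σ (Fin size) (T ∘ X) → count X ≡ k
    hasCard⇒count {X} card = sym (↔⇒≡ (↔-trans card (↔-sym (enumerate X))))

    -- Every block has `K ≥ k` elements, so the optimal set competes with `k` elements of each
    -- single block.
    worth-largest : ∀ {k X} → k ≤ K → (∀ Y → count Y ≡ k → worth Y ≤ worth X) → peak S 0 (λ _ → k) ≤ worth X
    worth-largest {k} {X} k≤K best-X = peak-lub S 0 λ j _ j< →
      ≤-trans (peak-mono S 0 (in-segment (Fin.fromℕ< j<) (Finₚ.toℕ-fromℕ< j<)))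
        (best-X (segment k≤K (Fin.fromℕ< j<)) (|segment| (Fin.fromℕ< j<)))
      where
      |segment| : ∀ i → count (segment k≤K i) ≡ k
      |segment| i = hasCard⇒count {segment k≤K i} (segment-↔ k≤K i)
      in-segment : ∀ i {j} → toℕ i ≡ j → ∀ l → (if l ≡ᵇ j then k else 0) ≤ count (inRow l (segment k≤K i))
      in-segment i {j} i≡j l with l ≡ᵇ j in eq
      ... | false = z≤n
      ... | true  = ≤-trans (≤-reflexive (sym (|segment| i)))
        (count-mono (segment k≤K i) (inRow l (segment k≤K i)) λ u h → T-inRow {l} {segment k≤K i} h
          (trans (≡ᵇ⇒≡ (row u) (toℕ i) (proj₁ (Equivalence.to T-∧ h))) (trans i≡j (sym (≡ᵇ⇒≡ l j (subst T (sym eq) tt))))))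

    restrict : ∀ {k} → k ≤ K → Vec (Fin size) K → Vec (Fin size) k
    restrict k≤K w = tabulate (λ j → Vec.lookup w (inject≤ j k≤K))

    -- The objective along a word.

    module _ (w : Vec (Fin size) K) where

      -- Positions are counted instead of distinct elements, so that the bound holds for every word.
      -- The later sums range over all words, including those with repetitions, with which no order
      -- starts.
      inPrefix : (ℕ → Bool) → ℕ → Fin K → Bool
      inPrefix p k j = (toℕ j <ᵇ k) ∧ p (row (Vec.lookup w j))

      rowCount below : ℕ → ℕ → ℕ
      rowCount i k = count (inPrefix (_≡ᵇ i) k)
      below    i k = count (inPrefix (_<ᵇ i) k)

      inPrefix-mono : ∀ p {k l} → k ≤ l → count (inPrefix p k) ≤ count (inPrefix p l)
      inPrefix-mono p {k} {l} k≤l = count-mono (inPrefix p k) (inPrefix p l) λ j h →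
        let j<k , pj = Equivalence.to (T-∧ {toℕ j <ᵇ k}) h in
        Equivalence.from T-∧ (<⇒<ᵇ (<-≤-trans (<ᵇ⇒< (toℕ j) k j<k) k≤l) , pj)

      below+rowCount : ∀ i k → below i k + rowCount i k ≤ below (suc i) k
      below+rowCount i k = count-disjoint (inPrefix (_<ᵇ i) k) (inPrefix (_≡ᵇ i) k) (inPrefix (_<ᵇ suc i) k)
        (λ j h → let j<k , r<i = Equivalence.to (T-∧ {toℕ j <ᵇ k}) h in
          Equivalence.from T-∧ (j<k , <⇒<ᵇ (m<n⇒m<1+n (<ᵇ⇒< (row (Vec.lookup w j)) i r<i))))
        (λ j h → let j<k , r≡i = Equivalence.to (T-∧ {toℕ j <ᵇ k}) h in
          Equivalence.from T-∧ (j<k , <⇒<ᵇ (s≤s (≤-reflexive (≡ᵇ⇒≡ (row (Vec.lookup w j)) i r≡i)))))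
        (λ j h h′ → <-irrefl
          (≡ᵇ⇒≡ (row (Vec.lookup w j)) i (proj₂ (Equivalence.to (T-∧ {toℕ j <ᵇ k}) h′)))
          (<ᵇ⇒< (row (Vec.lookup w j)) i (proj₂ (Equivalence.to (T-∧ {toℕ j <ᵇ k}) h))))

      inPrefix≤ : ∀ p k → count (inPrefix p k) ≤ k
      inPrefix≤ p k = ≤-trans
        (count-mono (inPrefix p k) (λ j → toℕ j <ᵇ k) λ j h → proj₁ (Equivalence.to (T-∧ {toℕ j <ᵇ k}) h))
        (count-< {K} k)

      value : ℕ → ℕ
      value k = peak S 0 (λ i → rowCount i k)

      value-mono : ∀ {k l} → k ≤ l → value k ≤ value l
      value-mono k≤l = peak-mono S 0 λ i → inPrefix-mono (_≡ᵇ i) k≤l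

      value-0≤0 : value 0 ≤ 0
      value-0≤0 = ≤-trans (peak-mono S 0 λ i → inPrefix≤ (_≡ᵇ i) 0) (≤-reflexive (empty S 0))
        where
        empty : ∀ is i → peak is i (λ _ → 0) ≡ 0
        empty []             i = refl
        empty ((s , d) ∷ is) i rewrite ⊓-zeroʳ s | *-zeroʳ d = empty is (suc i)

      worth≤value : ∀ {k X} (k≤K : k ≤ K) → (∀ u → T (X u) → u ∈ restrict k≤K w) → worth X ≤ value k
      worth≤value {k} {X} k≤K X⊆ = peak-mono S 0 λ i →
        count-image (Vec.lookup w) (inPrefix (_≡ᵇ i) k) (inRow i X) λ u h → image i u h
        where
        image : ∀ i u → T (inRow i X u) → ∃ λ j → T (inPrefix (_≡ᵇ i) k j) × Vec.lookup w j ≡ u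
        image i u h with inRow-T {i} {X} h
        ... | Xu , ru≡i = inject≤ j k≤K
          , Equivalence.from T-∧ (<⇒<ᵇ (subst (_< k) (sym (Finₚ.toℕ-inject≤ j k≤K)) (Finₚ.toℕ<n j))
              , ≡⇒≡ᵇ (row (Vec.lookup w (inject≤ j k≤K))) i (trans (cong row w[j]≡u) ru≡i))
          , w[j]≡u
          where
          j = index (X⊆ u Xu)
          w[j]≡u : Vec.lookup w (inject≤ j k≤K) ≡ u
          w[j]≡u = trans (sym (lookup∘tabulate (λ j → Vec.lookup w (inject≤ j k≤K)) j)) (sym (lookup-index (X⊆ u Xu)))

      total-value≤best : ∀ Ts → AllPairs (λ t u → proj₁ t ≤ proj₁ u) Ts → Denser S →
        total Ts value ≤ best Ts S 0 (λ _ → 0) 0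
      total-value≤best Ts sorted denser = total≤best Ts sorted rowCount below
        (λ i → inPrefix-mono (_≡ᵇ i)) (λ i → inPrefix-mono (_<ᵇ i)) below+rowCount (λ i → inPrefix≤ (_<ᵇ i))
        value value-mono S 0 0 denser z≤n z≤n
        (λ _ k≤0 → ≤-trans (value-mono k≤0) value-0≤0) (λ _ _ → ≤-refl)

-- Cauchy reals, finite sums and finite expectations.

module Reals where

  open import Defs as D using (ℝ; seq; cauchy; fromℚ; 0ℝ; 1ℝ; ∑)
  open import Data.Empty using (⊥-elim)
  open import Data.Integer as ℤ using (+_)
  import Data.Integer.Properties as ℤₚ
  open import Data.List using (List; []; _∷_; _++_; map)
  open import Data.List.Membership.Propositional using (_∈_)
  open import Data.List.Membership.Propositional.Properties using (∈-∃++; ∈-++⁻; ∈-++⁺ˡ; ∈-++⁺ʳ)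
  open import Data.List.Relation.Unary.All as All using (All; []; _∷_)
  open import Data.List.Relation.Unary.AllPairs using ([]; _∷_)
  open import Data.List.Relation.Unary.Any using (here; there)
  open import Data.List.Relation.Unary.Unique.Propositional using (Unique)
  open import Data.Nat as ℕ using (ℕ; suc; NonZero)
  open import Data.Nat.Coprimality using (1-coprimeTo)
  import Data.Nat.Coprimality as Coprimality
  import Data.Nat.Properties as ℕₚ
  open import Data.Product using (_,_; proj₁; proj₂)
  open import Data.Rational as ℚ using (ℚ; mkℚ; 0ℚ; 1ℚ; ½; toℚᵘ)
  import Data.Rational.Properties as ℚₚ
  open import Data.Rational.Solver using (module +-*-Solver)
  open import Data.Rational.Unnormalised using (*≡*; mkℚᵘ)
  import Data.Rational.Unnormalised.Properties as ℚᵘₚ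
  open import Data.Sum using (_⊎_; inj₁; inj₂)
  open import Function using (_∘_)
  open import Relation.Binary.PropositionalEquality

  -- Given by the constructor and not as `+ n / 1`, so that no reduction by a gcd blocks computation
  -- for a variable `n`.
  ι : ℕ → ℚ
  ι n = mkℚ (+ n) 0 (Coprimality.sym (1-coprimeTo n))

  ι-+ : ∀ m n → ι (m ℕ.+ n) ≡ ι m ℚ.+ ι n
  ι-+ m n = ℚₚ.toℚᵘ-injective (ℚᵘₚ.≃-trans (*≡* eq) (ℚᵘₚ.≃-sym (ℚₚ.toℚᵘ-homo-+ (ι m) (ι n))))
    where
    eq : + (m ℕ.+ n) ℤ.* + 1 ≡ (+ m ℤ.* + 1 ℤ.+ + n ℤ.* + 1) ℤ.* + 1
    eq = cong (ℤ._* + 1) (sym (cong₂ ℤ._+_ (ℤₚ.*-identityʳ (+ m)) (ℤₚ.*-identityʳ (+ n))))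

  ι-* : ∀ m n → ι (m ℕ.* n) ≡ ι m ℚ.* ι n
  ι-* m n = ℚₚ.toℚᵘ-injective (ℚᵘₚ.≃-trans (*≡* (cong (ℤ._* + 1) (ℤₚ.pos-* m n)))
    (ℚᵘₚ.≃-sym (ℚₚ.toℚᵘ-homo-* (ι m) (ι n))))

  ι-mono : ∀ {m n} → m ℕ.≤ n → ι m ℚ.≤ ι n
  ι-mono m≤n = ℚ.*≤* (ℤₚ.*-monoʳ-≤-nonNeg (+ 1) (ℤ.+≤+ m≤n))

  ι-/ : ∀ a b .{{_ : NonZero b}} → ι b ℚ.* (+ a ℚ./ b) ≡ ι a
  ι-/ a (suc b) = ℚₚ.toℚᵘ-injective (ℚᵘₚ.≃-trans (ℚₚ.toℚᵘ-homo-* (ι (suc b)) (+ a ℚ./ suc b))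
    (ℚᵘₚ.≃-trans (ℚᵘₚ.*-congˡ {toℚᵘ (ι (suc b))} (ℚₚ.toℚᵘ-fromℚᵘ (mkℚᵘ (+ a) b))) (*≡* eq)))
    where
    eq : + suc b ℤ.* + a ℤ.* + 1 ≡ + a ℤ.* (+ 1 ℤ.* + suc b)
    eq = trans (ℤₚ.*-identityʳ _) (trans (ℤₚ.*-comm (+ suc b) (+ a)) (cong (+ a ℤ.*_) (sym (ℤₚ.*-identityˡ _))))

  ι-pos : ∀ n .{{_ : NonZero n}} → ℚ.Positive (ι n)
  ι-pos (suc n) = _

  0<½*ε : ∀ {ε} → 0ℚ ℚ.< ε → 0ℚ ℚ.< ½ ℚ.* ε
  0<½*ε {ε} 0<ε = ℚₚ.positive⁻¹ _ {{ℚₚ.pos*pos⇒pos ½ ε {{ℚ.positive 0<ε}}}}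

  ½*ε+½*ε : ∀ ε → ½ ℚ.* ε ℚ.+ ½ ℚ.* ε ≡ ε
  ½*ε+½*ε ε = trans (sym (ℚₚ.*-distribʳ-+ ε ½ ½)) (ℚₚ.*-identityˡ ε)

  x≤x+ε : ∀ x {ε} → 0ℚ ℚ.< ε → x ℚ.≤ x ℚ.+ ε
  x≤x+ε x {ε} 0<ε = subst (ℚ._≤ x ℚ.+ ε) (ℚₚ.+-identityʳ x) (ℚₚ.+-monoʳ-≤ x (ℚₚ.<⇒≤ 0<ε))

  ≤-pointwise : ∀ {x y} → (∀ n → seq x n ℚ.≤ seq y n) → x D.≤ y
  ≤-pointwise le ε 0<ε = 0 , λ n _ → ℚₚ.≤-trans (le n) (x≤x+ε _ 0<ε)

  ≤-≡ : ∀ {x y} → (∀ n → seq x n ≡ seq y n) → x D.≤ y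
  ≤-≡ {x} {y} eq = ≤-pointwise {x} {y} (λ n → ℚₚ.≤-reflexive (eq n))

  ≤-trans : ∀ {x y z} → x D.≤ y → y D.≤ z → x D.≤ z
  ≤-trans {x} {y} {z} x≤y y≤z ε 0<ε with x≤y _ (0<½*ε 0<ε) | y≤z _ (0<½*ε 0<ε)
  ... | M , p | N , q = M ℕ.⊔ N , λ n le → begin
    seq x n                                   ≤⟨ p n (ℕₚ.m⊔n≤o⇒m≤o M N le) ⟩
    seq y n ℚ.+ ½ ℚ.* ε                       ≤⟨ ℚₚ.+-monoˡ-≤ _ (q n (ℕₚ.m⊔n≤o⇒n≤o M N le)) ⟩
    seq z n ℚ.+ ½ ℚ.* ε ℚ.+ ½ ℚ.* ε           ≡⟨ trans (ℚₚ.+-assoc (seq z n) _ _) (cong (seq z n ℚ.+_) (½*ε+½*ε ε)) ⟩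
    seq z n ℚ.+ ε                             ∎
    where open ℚₚ.≤-Reasoning

  ≤-+ε : ∀ {x y} → (∀ ε → 0ℚ ℚ.< ε → x D.≤ y D.+ fromℚ ε) → x D.≤ y
  ≤-+ε {x} {y} h ε 0<ε with h _ (0<½*ε 0<ε) _ (0<½*ε 0<ε)
  ... | N , p = N , λ n le → subst (seq x n ℚ.≤_)
    (trans (ℚₚ.+-assoc (seq y n) _ _) (cong (seq y n ℚ.+_) (½*ε+½*ε ε))) (p n le)

  +-mono : ∀ {x y u v} → x D.≤ y → u D.≤ v → x D.+ u D.≤ y D.+ v
  +-mono {x} {y} {u} {v} x≤y u≤v ε 0<ε with x≤y _ (0<½*ε 0<ε) | u≤v _ (0<½*ε 0<ε)
  ... | M , p | N , q = M ℕ.⊔ N , λ n le → begin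
    seq x n ℚ.+ seq u n
      ≤⟨ ℚₚ.+-mono-≤ (p n (ℕₚ.m⊔n≤o⇒m≤o M N le)) (q n (ℕₚ.m⊔n≤o⇒n≤o M N le)) ⟩
    (seq y n ℚ.+ ½ ℚ.* ε) ℚ.+ (seq v n ℚ.+ ½ ℚ.* ε)
      ≡⟨ solve 3 (λ a b c → (a :+ c) :+ (b :+ c) := (a :+ b) :+ (c :+ c)) refl (seq y n) (seq v n) (½ ℚ.* ε) ⟩
    (seq y n ℚ.+ seq v n) ℚ.+ (½ ℚ.* ε ℚ.+ ½ ℚ.* ε)
      ≡⟨ cong ((seq y n ℚ.+ seq v n) ℚ.+_) (½*ε+½*ε ε) ⟩
    (seq y n ℚ.+ seq v n) ℚ.+ ε ∎
    where
    open ℚₚ.≤-Reasoning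
    open +-*-Solver

  -- The order compares limits, so `0ℝ ≤ a` still allows negative terms, which would reverse
  -- termwise inequalities. Multiplication by `a` therefore asks for terms that are eventually
  -- non-negative and bounded; the bound turns the slack `ε` into `ε / bound`.
  record BoundedFactor (a : ℝ) : Set where
    field
      bound      : ℚ
      bound-pos  : ℚ.Positive bound
      from       : ℕ
      nonneg     : ∀ n → from ℕ.≤ n → 0ℚ ℚ.≤ seq a n
      ≤bound     : ∀ n → from ℕ.≤ n → seq a n ℚ.≤ bound

  *-mono : ∀ {a x y} → BoundedFactor a → x D.≤ y → a D.* x D.≤ a D.* y
  *-mono {a} {x} {y} bf x≤y ε 0<ε = from ℕ.⊔ N , λ n le → begin
    seq a n ℚ.* seq x n
      ≤⟨ ℚₚ.*-monoˡ-≤-nonNeg (seq a n) {{ℚ.nonNegative (nonneg n (ℕₚ.m⊔n≤o⇒m≤o from N le))}} (p n (ℕₚ.m⊔n≤o⇒n≤o from N le)) ⟩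
    seq a n ℚ.* (seq y n ℚ.+ δ)
      ≡⟨ ℚₚ.*-distribˡ-+ (seq a n) (seq y n) δ ⟩
    seq a n ℚ.* seq y n ℚ.+ seq a n ℚ.* δ
      ≤⟨ ℚₚ.+-monoʳ-≤ (seq a n ℚ.* seq y n)
           (ℚₚ.*-monoʳ-≤-nonNeg δ {{ℚ.nonNegative (ℚₚ.<⇒≤ 0<δ)}} (≤bound n (ℕₚ.m⊔n≤o⇒m≤o from N le))) ⟩
    seq a n ℚ.* seq y n ℚ.+ bound ℚ.* δ
      ≡⟨ cong (seq a n ℚ.* seq y n ℚ.+_) bound*δ ⟩
    seq a n ℚ.* seq y n ℚ.+ ε ∎
    where
    open ℚₚ.≤-Reasoning
    open BoundedFactor bf
    instance
      _ = bound-pos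
      _ = ℚₚ.pos⇒nonZero bound
      _ = ℚₚ.1/pos⇒pos bound
      _ = ℚ.positive 0<ε
    δ = ε ℚ.* ℚ.1/ bound
    0<δ : 0ℚ ℚ.< δ
    0<δ = ℚₚ.positive⁻¹ δ {{ℚₚ.pos*pos⇒pos ε (ℚ.1/ bound)}}
    bound*δ : bound ℚ.* δ ≡ ε
    bound*δ = trans (ℚₚ.*-comm bound δ) (trans (ℚₚ.*-assoc ε (ℚ.1/ bound) bound)
      (trans (cong (ε ℚ.*_) (ℚₚ.*-inverseˡ bound)) (ℚₚ.*-identityʳ ε)))
    N = proj₁ (x≤y δ 0<δ)
    p = proj₂ (x≤y δ 0<δ)

  ι-factor : ∀ k → BoundedFactor (fromℚ (ι k))
  ι-factor k = record
    { bound     = ι (suc k)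
    ; bound-pos = _
    ; from     = 0
    ; nonneg    = λ _ _ → ι-mono ℕ.z≤n
    ; ≤bound    = λ _ _ → ι-mono (ℕₚ.n≤1+n k)
    }

  -- With slack `½`, a limit of at least 1 forces the terms to be eventually at least `½`.
  ≥1-factor : ∀ a → 1ℝ D.≤ a → BoundedFactor a
  ≥1-factor a 1≤a with 1≤a ½ (ℚₚ.positive⁻¹ ½) | cauchy a 1ℚ (ℚₚ.positive⁻¹ 1ℚ)
  ... | M , p | N , q = record
    { bound     = 1ℚ ℚ.+ ℚ.∣ seq a N ∣
    ; bound-pos = ℚₚ.pos+nonNeg⇒pos 1ℚ ℚ.∣ seq a N ∣ {{ℚₚ.∣-∣-nonNeg (seq a N)}}
    ; from     = M ℕ.⊔ N
    ; nonneg    = λ n le → ℚₚ.≤-trans (ℚₚ.nonNegative⁻¹ ½)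
        (subst₂ ℚ._≤_ refl (trans (ℚₚ.+-assoc (seq a n) ½ (ℚ.- ½)) (ℚₚ.+-identityʳ (seq a n)))
          (ℚₚ.+-monoˡ-≤ (ℚ.- ½) (p n (ℕₚ.m⊔n≤o⇒m≤o M N le))))
    ; ≤bound    = λ n le → begin
        seq a n                                 ≡⟨ solve 2 (λ a b → a := (a :+ :- b) :+ b) refl (seq a n) (seq a N) ⟩
        (seq a n ℚ.- seq a N) ℚ.+ seq a N       ≤⟨ ℚₚ.+-mono-≤
          (ℚₚ.≤-trans (p≤∣p∣ _) (ℚₚ.<⇒≤ (q n N (ℕₚ.m⊔n≤o⇒n≤o M N le) ℕₚ.≤-refl))) (p≤∣p∣ (seq a N)) ⟩
        1ℚ ℚ.+ ℚ.∣ seq a N ∣                     ∎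
    }
    where
    open ℚₚ.≤-Reasoning
    open +-*-Solver
    p≤∣p∣ : ∀ p → p ℚ.≤ ℚ.∣ p ∣
    p≤∣p∣ p with ℚₚ.≤-total 0ℚ p
    ... | inj₁ 0≤p = ℚₚ.≤-reflexive (sym (ℚₚ.0≤p⇒∣p∣≡p 0≤p))
    ... | inj₂ p≤0 = ℚₚ.≤-trans p≤0 (ℚₚ.nonNegative⁻¹ ℚ.∣ p ∣ {{ℚₚ.∣-∣-nonNeg p}})

  module _ {I : Set} where

    ∑-map : ∀ {J : Set} (a : I → ℝ) (g : J → I) js → ∑ a (map g js) ≡ ∑ (a ∘ g) js
    ∑-map a g []       = refl
    ∑-map a g (j ∷ js) = cong (a (g j) D.+_) (∑-map a g js)

    ∑-nonneg : ∀ (a : I → ℝ) → (∀ i → 0ℝ D.≤ a i) → ∀ is → 0ℝ D.≤ ∑ a is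
    ∑-nonneg a a≥0 []       = ≤-≡ {0ℝ} {0ℝ} λ _ → refl
    ∑-nonneg a a≥0 (i ∷ is) = ≤-trans {0ℝ} {0ℝ D.+ 0ℝ} {∑ a (i ∷ is)} (≤-≡ {0ℝ} {0ℝ D.+ 0ℝ} λ _ → refl)
      (+-mono {0ℝ} {a i} {0ℝ} {∑ a is} (a≥0 i) (∑-nonneg a a≥0 is))

    ∑-middle : ∀ (a : I → ℝ) xs i ys n → seq (∑ a (xs ++ i ∷ ys)) n ≡ seq (a i) n ℚ.+ seq (∑ a (xs ++ ys)) n
    ∑-middle a []       i ys n = refl
    ∑-middle a (x ∷ xs) i ys n = trans (cong (seq (a x) n ℚ.+_) (∑-middle a xs i ys n))
      (solve 3 (λ a b c → a :+ (b :+ c) := b :+ (a :+ c)) refl (seq (a x) n) (seq (a i) n) (seq (∑ a (xs ++ ys)) n))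
      where open +-*-Solver

    -- Each element of `is` is struck from `js` when it is met, as it does not recur in `is`; what
    -- remains of `js` contributes a non-negative amount.
    ∑-unique : ∀ (a : I → ℝ) → (∀ i → 0ℝ D.≤ a i) → ∀ is js → Unique is →
      (∀ {i} → i ∈ is → i ∈ js ⊎ a i D.≤ 0ℝ) → ∑ a is D.≤ ∑ a js
    ∑-unique a a≥0 []       js _ _ = ∑-nonneg a a≥0 js
    ∑-unique a a≥0 (i ∷ is) js (i∉is ∷ unique) cover with cover (here refl)
    ... | inj₂ ai≤0 = ≤-trans {∑ a (i ∷ is)} {0ℝ D.+ ∑ a js} {∑ a js}
      (+-mono {a i} {0ℝ} {∑ a is} {∑ a js} ai≤0 (∑-unique a a≥0 is js unique (cover ∘ there)))
      (≤-≡ {0ℝ D.+ ∑ a js} {∑ a js} λ n → ℚₚ.+-identityˡ _)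
    ... | inj₁ i∈js with ∈-∃++ i∈js
    ...   | xs , ys , refl = ≤-trans {∑ a (i ∷ is)} {a i D.+ ∑ a (xs ++ ys)} {∑ a (xs ++ i ∷ ys)}
      (+-mono {a i} {a i} {∑ a is} {∑ a (xs ++ ys)} (≤-≡ {a i} {a i} λ _ → refl)
        (∑-unique a a≥0 is (xs ++ ys) unique cover′))
      (≤-≡ {a i D.+ ∑ a (xs ++ ys)} {∑ a (xs ++ i ∷ ys)} λ n → sym (∑-middle a xs i ys n))
      where
      cover′ : ∀ {j} → j ∈ is → j ∈ xs ++ ys ⊎ a j D.≤ 0ℝ
      cover′ j∈is with cover (there j∈is)
      ... | inj₂ le = inj₂ le
      ... | inj₁ j∈ with ∈-++⁻ xs j∈
      ...   | inj₁ j∈xs = inj₁ (∈-++⁺ˡ j∈xs)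
      ...   | inj₂ (here refl) = ⊥-elim (All.lookup i∉is j∈is refl)
      ...   | inj₂ (there j∈ys) = inj₁ (∈-++⁺ʳ xs j∈ys)

    module Expectation (P : I → ℝ) (P≥0 : ∀ i → 0ℝ D.≤ P i) where

      𝔼 : List I → (I → ℕ) → ℝ
      𝔼 is g = ∑ (λ i → P i D.* fromℚ (ι (g i))) is

      𝔼-linear : ∀ is p g h n → ι p ℚ.* seq (𝔼 is g) n ℚ.+ seq (𝔼 is h) n ≡ seq (𝔼 is (λ i → p ℕ.* g i ℕ.+ h i)) n
      𝔼-linear []       p g h n = trans (cong (ℚ._+ 0ℚ) (ℚₚ.*-zeroʳ (ι p))) refl
      𝔼-linear (i ∷ is) p g h n = begin
        ι p ℚ.* (x ℚ.* ι (g i) ℚ.+ u) ℚ.+ (x ℚ.* ι (h i) ℚ.+ v)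
          ≡⟨ solve 6 (λ p x g h u v → p :* (x :* g :+ u) :+ (x :* h :+ v) := x :* (p :* g :+ h) :+ (p :* u :+ v))
               refl (ι p) x (ι (g i)) (ι (h i)) u v ⟩
        x ℚ.* (ι p ℚ.* ι (g i) ℚ.+ ι (h i)) ℚ.+ (ι p ℚ.* u ℚ.+ v)
          ≡⟨ cong₂ (λ y z → x ℚ.* y ℚ.+ z)
               (sym (trans (ι-+ (p ℕ.* g i) (h i)) (cong (ℚ._+ ι (h i)) (ι-* p (g i))))) (𝔼-linear is p g h n) ⟩
        x ℚ.* ι (p ℕ.* g i ℕ.+ h i) ℚ.+ seq (𝔼 is (λ i → p ℕ.* g i ℕ.+ h i)) n ∎
        where
        open ≡-Reasoning
        open +-*-Solver
        x = seq (P i) n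
        u = seq (𝔼 is g) n
        v = seq (𝔼 is h) n

      -- `P i` is non-negative only in the limit, so it cannot serve as the factor. Instead
      -- `0ℝ ≤ P i` is multiplied by the natural number `h i ∸ g i`, and the product is added to
      -- `P i * g i`.
      𝔼-mono : ∀ is {g h} → (∀ i → g i ℕ.≤ h i) → 𝔼 is g D.≤ 𝔼 is h
      𝔼-mono []       le = ≤-≡ {0ℝ} {0ℝ} λ _ → refl
      𝔼-mono (i ∷ is) {g} {h} le = +-mono {P i D.* fromℚ (ι (g i))} {P i D.* fromℚ (ι (h i))} {𝔼 is g} {𝔼 is h}
        (≤-trans {P i D.* fromℚ (ι (g i))} {P i D.* fromℚ (ι (g i)) D.+ fromℚ (ι e) D.* 0ℝ} {P i D.* fromℚ (ι (h i))}
          (≤-≡ {P i D.* fromℚ (ι (g i))} {P i D.* fromℚ (ι (g i)) D.+ fromℚ (ι e) D.* 0ℝ}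
            λ n → sym (trans (cong (seq (P i) n ℚ.* ι (g i) ℚ.+_) (ℚₚ.*-zeroʳ (ι e))) (ℚₚ.+-identityʳ _)))
          (≤-trans {P i D.* fromℚ (ι (g i)) D.+ fromℚ (ι e) D.* 0ℝ} {P i D.* fromℚ (ι (g i)) D.+ fromℚ (ι e) D.* P i} {P i D.* fromℚ (ι (h i))}
            (+-mono {P i D.* fromℚ (ι (g i))} {P i D.* fromℚ (ι (g i))} {fromℚ (ι e) D.* 0ℝ} {fromℚ (ι e) D.* P i}
              (≤-≡ {P i D.* fromℚ (ι (g i))} {P i D.* fromℚ (ι (g i))} λ _ → refl)
              (*-mono {fromℚ (ι e)} {0ℝ} {P i} (ι-factor e) (P≥0 i)))
            (≤-≡ {P i D.* fromℚ (ι (g i)) D.+ fromℚ (ι e) D.* P i} {P i D.* fromℚ (ι (h i))} split)))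
        (𝔼-mono is {g} {h} le)
        where
        e = h i ℕ.∸ g i
        split : ∀ n → seq (P i) n ℚ.* ι (g i) ℚ.+ ι e ℚ.* seq (P i) n ≡ seq (P i) n ℚ.* ι (h i)
        split n = trans (cong (seq (P i) n ℚ.* ι (g i) ℚ.+_) (ℚₚ.*-comm (ι e) (seq (P i) n)))
          (trans (sym (ℚₚ.*-distribˡ-+ (seq (P i) n) (ι (g i)) (ι e)))
            (cong (seq (P i) n ℚ.*_) (trans (sym (ι-+ (g i) e)) (cong ι (ℕₚ.m+[n∸m]≡n (le i))))))

-- The blocks as an instance of the problem.

module BlockInstances where

  open Schedules
  open Counting
  open Reals
  open import Defs as D using (fromℚ; Countable; Instance; HasCard; finite)
  open import Data.Fin using (Fin)
  open import Data.Integer using (+_)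
  open import Data.List using (List)
  open import Data.Nat as ℕ using (ℕ; NonZero)
  open import Data.Product using (∃; _×_; _,_)
  open import Data.Rational as ℚ using (ℚ; 0ℚ; 1ℚ)
  import Data.Rational.Properties as ℚₚ
  open import Data.Rational.Solver using (module +-*-Solver)
  open import Function.Properties.Inverse using (↔-refl)
  open import Relation.Binary.PropositionalEquality

  ι-removal : ∀ n .{{_ : NonZero n}} {v v′} → n ℕ.* v ℕ.≤ n ℕ.* v′ ℕ.+ v →
    ι v ℚ.- ι v ℚ.* (+ 1 ℚ./ n) ℚ.≤ ι v′
  ι-removal n {v} {v′} le = begin
    ι v ℚ.- ι v ℚ.* r                       ≡⟨ cong (λ x → x ℚ.- ι v ℚ.* r) (scale v) ⟩
    ι (n ℕ.* v) ℚ.* r ℚ.- ι v ℚ.* r         ≤⟨ ℚₚ.+-monoˡ-≤ (ℚ.- (ι v ℚ.* r)) (ℚₚ.*-monoʳ-≤-nonNeg r {{r≥0}} (ι-mono le)) ⟩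
    ι (n ℕ.* v′ ℕ.+ v) ℚ.* r ℚ.- ι v ℚ.* r  ≡⟨ cong (λ x → x ℚ.* r ℚ.- ι v ℚ.* r) (ι-+ (n ℕ.* v′) v) ⟩
    (ι (n ℕ.* v′) ℚ.+ ι v) ℚ.* r ℚ.- ι v ℚ.* r
      ≡⟨ solve 3 (λ a b r → (a :+ b) :* r :+ :- (b :* r) := a :* r) refl (ι (n ℕ.* v′)) (ι v) r ⟩
    ι (n ℕ.* v′) ℚ.* r                      ≡⟨ sym (scale v′) ⟩
    ι v′ ∎
    where
    open ℚₚ.≤-Reasoning
    open +-*-Solver
    r = + 1 ℚ./ n
    r≥0 : ℚ.NonNegative r
    r≥0 = ℚₚ.normalize-nonNeg 1 n
    scale : ∀ v → ι v ≡ ι (n ℕ.* v) ℚ.* r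
    scale v = begin-equality
      ι v                   ≡⟨ sym (ℚₚ.*-identityʳ (ι v)) ⟩
      ι v ℚ.* 1ℚ            ≡⟨ cong (ι v ℚ.*_) (sym (ι-/ 1 n)) ⟩
      ι v ℚ.* (ι n ℚ.* r)   ≡⟨ solve 3 (λ a b c → a :* (b :* c) := (b :* a) :* c) refl (ι v) (ι n) r ⟩
      (ι n ℚ.* ι v) ℚ.* r   ≡⟨ cong (ℚ._* r) (sym (ι-* n v)) ⟩
      ι (n ℕ.* v) ℚ.* r     ∎

  module BlockInstance (S : List (ℕ × ℕ)) (K : ℕ) where

    open Blocks S K public

    countable : Countable (Fin size)
    countable = record { card = finite size ; enumeration = ↔-refl }

    optimal : ∀ k → k ℕ.≤ size → ∃ λ X → HasCard X k × (∀ Y → HasCard Y k → fromℚ (ι (worth Y)) D.≤ fromℚ (ι (worth X)))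
    optimal k k≤ with largest size k k≤ worth (λ {X} {Y} → worth-ext {X} {Y})
    ... | X , |X| , best-X = X , subst (HasCard X) |X| (enumerate X)
      , λ Y |Y| → ≤-pointwise {fromℚ (ι (worth Y))} {fromℚ (ι (worth X))} λ _ → ι-mono (best-X Y (hasCard⇒count {Y} |Y|))

    blocks : Instance
    blocks = record
      { U           = Fin size
      ; countable   = countable
      ; f           = λ X → fromℚ (ι (worth X))
      ; f-nonneg    = λ X → ≤-pointwise {fromℚ 0ℚ} {fromℚ (ι (worth X))} λ _ → ι-mono ℕ.z≤n
      ; monotone    = λ X Y X⊆Y → ≤-pointwise {fromℚ (ι (worth X))} {fromℚ (ι (worth Y))} λ _ → ι-mono (worth-mono {X} {Y} X⊆Y)
      ; accountable = λ X n |X| → let e , Xe , le = accountable X n (hasCard⇒count {X} |X|) in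
          e , Xe , ≤-pointwise {fromℚ (ι (worth X)) D.- fromℚ (ι (worth X)) D.÷ n} {fromℚ (ι (worth (X without e)))}
            λ _ → ι-removal n le
      ; opt-exists  = optimal
      }

    open Instance blocks using (Opt)

    Opt≥ : ∀ k (k≤ : k ℕ.≤ size) → k ℕ.≤ K → fromℚ (ι (peak S 0 (λ _ → k))) D.≤ Opt k k≤
    Opt≥ k k≤ k≤K with largest size k k≤ worth (λ {X} {Y} → worth-ext {X} {Y})
    ... | X , |X| , best-X = ≤-pointwise {fromℚ (ι (peak S 0 (λ _ → k)))} {fromℚ (ι (worth X))}
      λ _ → ι-mono (worth-largest {k} {X} k≤K best-X)

-- The law of the first `K` elements.

module RandomWords where

  open Schedules
  open Counting
  open Reals
  open BlockInstances
  open import Defs as D using (ℝ; fromℚ; seq; 0ℝ; 1ℝ; ∑; HasSum; Countable; RandomizedSolution; 𝒫)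
  open import Data.Bool using (true; false; if_then_else_; T)
  open import Data.Fin as Fin using (Fin; inject≤)
  import Data.Fin.Properties as Finₚ
  open import Data.List using (List; []; _∷_; map; cartesianProductWith; allFin)
  open import Data.List.Membership.Propositional using (_∈_)
  open import Data.List.Membership.Propositional.Properties using (∈-cartesianProductWith⁺; ∈-allFin; ∈-map⁺)
  open import Data.List.Relation.Unary.All as All using (All; []; _∷_)
  open import Data.List.Relation.Unary.AllPairs using ([]; _∷_)
  open import Data.List.Relation.Unary.Any using (here; there)
  open import Data.List.Relation.Unary.Unique.Propositional using (Unique)
  open import Data.List.Relation.Unary.Unique.Propositional.Properties using (cartesianProductWith⁺; allFin⁺; map⁺)
  import Data.List.Relation.Unary.All.Properties as Allₚ
  open import Data.Nat as ℕ using (ℕ; zero; suc)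
  import Data.Nat.Properties as ℕₚ
  open import Data.Product using (∃; _×_; _,_; proj₁; proj₂)
  open import Data.Rational as ℚ using (0ℚ)
  import Data.Rational.Properties as ℚₚ
  open import Data.Rational.Solver using (module +-*-Solver)
  open import Data.Sum using (_⊎_; inj₁; inj₂)
  open import Data.Unit using (tt)
  open import Data.Vec using (Vec; []; _∷_)
  open import Data.Vec.Properties using (tabulate-cong; lookup∘tabulate; ∷-injective; ≡-dec)
  import Data.Vec.Membership.DecPropositional as DecMembership
  open import Function using (_∘_; _⇔_; mk⇔; Equivalence; Inverse)
  open import Relation.Binary.PropositionalEquality
  open import Relation.Nullary using (¬_; Dec; yes; no; does; contradiction)

  T-does : ∀ {A : Set} (d : Dec A) → T (does d) → A
  T-does (yes a) _ = a

  does-T : ∀ {A : Set} (d : Dec A) → A → T (does d)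
  does-T (yes _) _ = tt
  does-T (no ¬a) a = contradiction a ¬a

  words : ∀ N n → List (Vec (Fin N) n)
  words N zero    = [] ∷ []
  words N (suc n) = cartesianProductWith _∷_ (allFin N) (words N n)

  words-unique : ∀ N n → Unique (words N n)
  words-unique N zero    = [] ∷ []
  words-unique N (suc n) = cartesianProductWith⁺ _∷_ ∷-injective (allFin⁺ N) (words-unique N n)

  ∈-words : ∀ {N n} (w : Vec (Fin N) n) → w ∈ words N n
  ∈-words []      = here refl
  ∈-words (u ∷ w) = ∈-cartesianProductWith⁺ _∷_ (∈-allFin u) (∈-words w)

  indices : ∀ {A : Set} → List A → List ℕ
  indices []       = []
  indices (x ∷ xs) = 0 ∷ map suc (indices xs)

  indices-unique : ∀ {A : Set} (xs : List A) → Unique (indices xs)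
  indices-unique []       = []
  indices-unique (x ∷ xs) =
    Allₚ.map⁺ (All.universal (λ _ ()) (indices xs)) ∷ map⁺ ℕₚ.suc-injective (indices-unique xs)

  x+x≤x⇒x≤0 : ∀ x → x D.+ (x D.+ 0ℝ) D.≤ x → x D.≤ 0ℝ
  x+x≤x⇒x≤0 x le ε 0<ε with le ε 0<ε
  ... | N , p = N , λ n N≤n → subst₂ ℚ._≤_
    (solve 1 (λ a → (a :+ (a :+ con 0ℚ)) :+ :- a := a) refl (seq x n))
    (solve 2 (λ a e → (a :+ e) :+ :- a := con 0ℚ :+ e) refl (seq x n) ε)
    (ℚₚ.+-monoˡ-≤ (ℚ.- seq x n) (p n N≤n))
    where open +-*-Solver

  module Words (S : List (ℕ × ℕ)) (K : ℕ) (K≤ : K ℕ.≤ Blocks.size S K)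
               (solution : RandomizedSolution (BlockInstance.blocks S K)) where

    open BlockInstance S K
    open Countable countable using (Order; prefix; startsWith; elements; _≟_)
    open RandomizedSolution solution
    open DecMembership _≟_ using (_∈?_)

    Word : ℕ → Set
    Word = Vec (Fin size)

    restrict-prefix : ∀ {k} (k≤K : k ℕ.≤ K) (k≤ : k ℕ.≤ size) (σ : Order) → restrict k≤K (prefix K K≤ σ) ≡ prefix k k≤ σ
    restrict-prefix k≤K k≤ σ = tabulate-cong λ j →
      trans (lookup∘tabulate (λ i → Inverse.to σ (inject≤ i K≤)) (inject≤ j k≤K))
            (cong (Inverse.to σ) (Finₚ.inject≤-trans j k≤K K≤))

    ∅-event : Event (λ _ → false)
    ∅-event = ∁-event full

    -- The empty event is the disjoint union of countably many copies of itself, and already two of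
    -- them have total at most `ℙ ∅-event`.
    ℙ∅≤0 : ℙ ∅-event D.≤ 0ℝ
    ℙ∅≤0 = x+x≤x⇒x≤0 (ℙ ∅-event) (proj₁
      (ℙ-⋃ ∅-event (λ _ _ → false) (λ _ → ∅-event) (λ _ → mk⇔ (λ ()) proj₂) (λ _ _ → proj₁))
      (0 ∷ 1 ∷ []) (((λ ()) ∷ []) ∷ ([] ∷ [])))

    P : Word K → ℝ
    P w = ℙ (prefix-event K≤ w)

    open Expectation P (λ w → ℙ-nonneg (prefix-event K≤ w)) public

    all : List (Word K)
    all = words size K

    module Cover {k} (k≤K : k ℕ.≤ K) (w : Word k) where

      extends? : ∀ W → Dec (restrict k≤K W ≡ w)
      extends? W = ≡-dec Fin._≟_ (restrict k≤K W) w

      extends : Word K → ℕ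
      extends W = indicator (does (extends? W))

      -- The events that σ starts with W, for the words W extending w; they partition
      -- the event that σ starts with w.
      part : List (Word K) → ℕ → 𝒫 Order
      part []       _       = λ _ → false
      part (W ∷ Ws) zero    = if does (extends? W) then startsWith K≤ W else λ _ → false
      part (W ∷ Ws) (suc i) = part Ws i

      part-event : ∀ Ws i → Event (part Ws i)
      part-event []       _       = ∅-event
      part-event (W ∷ Ws) (suc i) = part-event Ws i
      part-event (W ∷ Ws) zero with does (extends? W)
      ... | true  = prefix-event K≤ W
      ... | false = ∅-event

      part-head : ∀ W Ws → ℙ (part-event (W ∷ Ws) 0) D.≈ P W D.* fromℚ (ι (extends W))
      part-head W Ws with does (extends? W)
      ... | true  = ≤-≡ {P W} {P W D.* fromℚ (ι 1)} (λ n → sym (ℚₚ.*-identityʳ (seq (P W) n)))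
                  , ≤-≡ {P W D.* fromℚ (ι 1)} {P W} (λ n → ℚₚ.*-identityʳ (seq (P W) n))
      ... | false = ≤-trans {ℙ ∅-event} {0ℝ} {P W D.* 0ℝ} ℙ∅≤0 (≤-≡ {0ℝ} {P W D.* 0ℝ} (λ n → sym (ℚₚ.*-zeroʳ (seq (P W) n))))
                  , ≤-trans {P W D.* 0ℝ} {0ℝ} {ℙ ∅-event} (≤-≡ {P W D.* 0ℝ} {0ℝ} (λ n → ℚₚ.*-zeroʳ (seq (P W) n))) (ℙ-nonneg ∅-event)

      ∑-part : ∀ Ws → ∑ (λ i → ℙ (part-event Ws i)) (indices Ws) D.≈ 𝔼 Ws extends
      ∑-part [] = (≤-≡ {0ℝ} {0ℝ} λ _ → refl) , (≤-≡ {0ℝ} {0ℝ} λ _ → refl)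
      ∑-part (W ∷ Ws) rewrite ∑-map (λ i → ℙ (part-event (W ∷ Ws) i)) suc (indices Ws) =
        let h₁ , h₂ = part-head W Ws ; t₁ , t₂ = ∑-part Ws
            a = ℙ (part-event (W ∷ Ws) 0) ; b = P W D.* fromℚ (ι (extends W))
            c = ∑ (λ i → ℙ (part-event Ws i)) (indices Ws) ; d = 𝔼 Ws extends
        in +-mono {a} {b} {c} {d} h₁ t₁ , +-mono {b} {a} {d} {c} h₂ t₂

      part-outside : ∀ Ws i → i ∈ indices Ws ⊎ ℙ (part-event Ws i) D.≤ 0ℝ
      part-outside []       i       = inj₂ ℙ∅≤0
      part-outside (W ∷ Ws) zero    = inj₁ (here refl)
      part-outside (W ∷ Ws) (suc i) with part-outside Ws i
      ... | inj₁ i∈ = inj₁ (there (∈-map⁺ suc i∈))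
      ... | inj₂ le = inj₂ le

      part⁻ : ∀ Ws i {ω} → T (part Ws i ω) → prefix K K≤ ω ∈ Ws × restrict k≤K (prefix K K≤ ω) ≡ w
      part⁻ (W ∷ Ws) (suc i) h = let m , e = part⁻ Ws i h in there m , e
      part⁻ (W ∷ Ws) zero {ω} h with extends? W
      ... | yes e = let eq = T-does (≡-dec _≟_ (prefix K K≤ ω) W) h in here eq , trans (cong (restrict k≤K) eq) e

      part⁺ : ∀ Ws {ω} → prefix K K≤ ω ∈ Ws → restrict k≤K (prefix K K≤ ω) ≡ w → ∃ λ i → T (part Ws i ω)
      part⁺ (W ∷ Ws) (there m) e = let i , h = part⁺ Ws m e in suc i , h
      part⁺ (W ∷ Ws) {ω} (here refl) e = 0 , first
        where
        first : T (part (W ∷ Ws) 0 ω)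
        first with extends? W
        ... | yes _ = does-T (≡-dec _≟_ (prefix K K≤ ω) W) refl
        ... | no ¬e = contradiction e ¬e

      part-head-tail : ∀ W Ws → All (W ≢_) Ws → ∀ j ω → T (part (W ∷ Ws) 0 ω) → ¬ T (part Ws j ω)
      part-head-tail W Ws W∉ j ω h h′ with extends? W
      ... | yes _ = All.lookup W∉ (proj₁ (part⁻ Ws j h′)) (sym (T-does (≡-dec _≟_ (prefix K K≤ ω) W) h))

      part-disjoint : ∀ Ws → Unique Ws → ∀ {i j} → i ≢ j → ∀ ω → ¬ (T (part Ws i ω) × T (part Ws j ω))
      part-disjoint (W ∷ Ws) _        {zero}  {zero}  i≢j ω _ = i≢j refl
      part-disjoint (W ∷ Ws) (W∉ ∷ _) {zero}  {suc j} i≢j ω (h , h′) = part-head-tail W Ws W∉ j ω h h′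
      part-disjoint (W ∷ Ws) (W∉ ∷ _) {suc i} {zero}  i≢j ω (h , h′) = part-head-tail W Ws W∉ i ω h′ h
      part-disjoint (W ∷ Ws) (_ ∷ u)  {suc i} {suc j} i≢j ω h = part-disjoint Ws u (i≢j ∘ cong suc) ω h

      -- All parts beyond the list `all` are empty and hence null, so countable additivity becomes a
      -- finite sum. The event is arbitrary because `full` is covered as well, by the extensions of
      -- the empty word.
      cover : ∀ {A} (a : Event A) → (∀ ω → T (A ω) ⇔ restrict k≤K (prefix K K≤ ω) ≡ w) → ℙ a D.≈ 𝔼 all extends
      cover {A} a A⇔ =
          ≤-+ε {ℙ a} {𝔼 all extends} (λ ε 0<ε → let is , unique , le = proj₂ hasSum ε 0<ε in
            ≤-trans {ℙ a} {∑ p is D.+ fromℚ ε} {𝔼 all extends D.+ fromℚ ε} le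
              (+-mono {∑ p is} {𝔼 all extends} {fromℚ ε} {fromℚ ε}
                (≤-trans {∑ p is} {∑ p (indices all)} {𝔼 all extends}
                  (∑-unique p (λ i → ℙ-nonneg (part-event all i)) is (indices all) unique (λ {i} _ → part-outside all i))
                  (proj₁ (∑-part all)))
                (≤-≡ {fromℚ ε} {fromℚ ε} λ _ → refl)))
        , ≤-trans {𝔼 all extends} {∑ p (indices all)} {ℙ a} (proj₂ (∑-part all))
            (proj₁ hasSum (indices all) (indices-unique all))
        where
        p : ℕ → ℝ
        p i = ℙ (part-event all i)
        hasSum : HasSum p (ℙ a)
        hasSum = ℙ-⋃ a (part all) (part-event all)
          (λ ω → mk⇔ (λ h → part⁺ all (∈-words (prefix K K≤ ω)) (Equivalence.to (A⇔ ω) h))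
                     (λ (i , h) → Equivalence.from (A⇔ ω) (proj₂ (part⁻ all i h))))
          (part-disjoint all (words-unique size K))

    open Cover using (extends; cover)

    𝔼1≤1 : 𝔼 all (λ _ → 1) D.≤ 1ℝ
    𝔼1≤1 = ≤-trans {𝔼 all (λ _ → 1)} {ℙ full} {1ℝ}
      (≤-trans {𝔼 all (λ _ → 1)} {𝔼 all (extends ℕ.z≤n [])} {ℙ full}
        (𝔼-mono all λ _ → ℕₚ.≤-refl)
        (proj₂ (cover ℕ.z≤n [] full λ ω → mk⇔ (λ _ → refl) (λ _ → tt))))
      (proj₁ ℙ-full)

    module _ {k} (k≤K : k ℕ.≤ K) (g : Word k → ℕ) where

      hits : List (Word k) → Word K → ℕ
      hits []       W = 0
      hits (w ∷ ws) W = g w ℕ.* extends k≤K w W ℕ.+ hits ws W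

      hits-none : ∀ ws {W} → All (restrict k≤K W ≢_) ws → hits ws W ≡ 0
      hits-none []       []         = refl
      hits-none (w ∷ ws) {W} (≢w ∷ ≢ws) with ≡-dec Fin._≟_ (restrict k≤K W) w
      ... | yes eq = contradiction eq ≢w
      ... | no  _  = cong₂ ℕ._+_ (ℕₚ.*-zeroʳ (g w)) (hits-none ws ≢ws)

      -- `W` extends only one word of length `k`, so at most one summand survives.
      hits≤ : ∀ ws → Unique ws → ∀ W → hits ws W ℕ.≤ g (restrict k≤K W)
      hits≤ []       _          W = ℕ.z≤n
      hits≤ (w ∷ ws) (w∉ ∷ unique) W with ≡-dec Fin._≟_ (restrict k≤K W) w
      ... | yes refl = ℕₚ.≤-reflexive (trans (cong₂ ℕ._+_ (ℕₚ.*-identityʳ (g w)) (hits-none ws w∉)) (ℕₚ.+-identityʳ (g w)))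
      ... | no  _    = subst (λ x → x ℕ.+ hits ws W ℕ.≤ g (restrict k≤K W)) (sym (ℕₚ.*-zeroʳ (g w))) (hits≤ ws unique W)

      module _ (k≤ : k ℕ.≤ size) where

        term : Word k → ℝ
        term w = ℙ (prefix-event k≤ w) D.* fromℚ (ι (g w))

        -- Exchange of summations, once `cover` has written the probability of `w` as a sum over the
        -- words of length `K`.
        ∑-hits : ∀ ws → ∑ term ws D.≤ 𝔼 all (hits ws)
        ∑-hits [] = ∑-nonneg (λ W → P W D.* fromℚ (ι 0))
          (λ W → ≤-≡ {0ℝ} {P W D.* fromℚ (ι 0)} λ n → sym (ℚₚ.*-zeroʳ (seq (P W) n))) all
        ∑-hits (w ∷ ws) = ≤-trans {∑ term (w ∷ ws)} {fromℚ (ι (g w)) D.* e D.+ 𝔼 all (hits ws)} {𝔼 all (hits (w ∷ ws))}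
          (+-mono {term w} {fromℚ (ι (g w)) D.* e} {∑ term ws} {𝔼 all (hits ws)}
            (≤-trans {term w} {fromℚ (ι (g w)) D.* ℙ (prefix-event k≤ w)} {fromℚ (ι (g w)) D.* e}
              (≤-≡ {term w} {fromℚ (ι (g w)) D.* ℙ (prefix-event k≤ w)} λ n → ℚₚ.*-comm (seq (ℙ (prefix-event k≤ w)) n) (ι (g w)))
              (*-mono {fromℚ (ι (g w))} {ℙ (prefix-event k≤ w)} {e} (ι-factor (g w))
                (proj₁ (cover k≤K w (prefix-event k≤ w) startsWith⇔))))
            (∑-hits ws))
          (≤-≡ {fromℚ (ι (g w)) D.* e D.+ 𝔼 all (hits ws)} {𝔼 all (hits (w ∷ ws))}
            (𝔼-linear all (g w) (extends k≤K w) (hits ws)))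
          where
          e = 𝔼 all (extends k≤K w)
          startsWith⇔ : ∀ σ → T (startsWith k≤ w σ) ⇔ restrict k≤K (prefix K K≤ σ) ≡ w
          startsWith⇔ σ = mk⇔
            (λ h → trans (restrict-prefix k≤K k≤ σ) (T-does (≡-dec _≟_ (prefix k k≤ σ) w) h))
            (λ e → does-T (≡-dec _≟_ (prefix k k≤ σ) w) (trans (sym (restrict-prefix k≤K k≤ σ)) e))

        HasSum⇒≤𝔼 : ∀ {v} → HasSum term v → v D.≤ 𝔼 all (λ W → g (restrict k≤K W))
        HasSum⇒≤𝔼 {v} (_ , approx) = ≤-+ε {v} {E} λ ε 0<ε → let ws , unique , le = approx ε 0<ε in
          ≤-trans {v} {∑ term ws D.+ fromℚ ε} {E D.+ fromℚ ε} le
            (+-mono {∑ term ws} {E} {fromℚ ε} {fromℚ ε}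
              (≤-trans {∑ term ws} {𝔼 all (hits ws)} {E} (∑-hits ws) (𝔼-mono all (hits≤ ws unique)))
              (≤-≡ {fromℚ ε} {fromℚ ε} λ _ → refl))
          where
          E = 𝔼 all (λ W → g (restrict k≤K W))

    expected≤ : ∀ {k} (k≤K : k ℕ.≤ K) (k≤ : k ℕ.≤ size) {v} → IsExpectedValue k k≤ v → v D.≤ 𝔼 all (λ W → value W k)
    expected≤ {k} k≤K k≤ {v} h =
      ≤-trans {v} {𝔼 all (λ W → worth (elements (restrict k≤K W)))} {𝔼 all (λ W → value W k)}
        (HasSum⇒≤𝔼 {k} k≤K (λ w → worth (elements w)) k≤ {v} h)
        (𝔼-mono all λ W → worth≤value W k≤K λ u → T-does (u ∈? restrict k≤K W))

-- Averaging over times and words.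

module LowerBound where

  open Schedules
  open Counting
  open Reals
  open BlockInstances
  open RandomWords
  open import Defs as D using (fromℚ; seq; RandomizedSolution; RandomizedAlgorithm; CompetitiveRatioAtLeast; 0ℝ; 1ℝ)
  open import Data.Integer using (+_)
  open import Data.List using (List; []; _∷_)
  open import Data.List.Relation.Unary.All using (All; []; _∷_)
  open import Data.List.Relation.Unary.AllPairs using (AllPairs)
  open import Data.Nat as ℕ using (ℕ; NonZero)
  import Data.Nat.Properties as ℕₚ
  open import Data.Product using (_×_; _,_; proj₁)
  open import Data.Rational as ℚ using (ℚ; 0ℚ)
  import Data.Rational.Properties as ℚₚ
  open import Data.Rational.Solver using (module +-*-Solver)
  open import Data.Unit using (tt)
  open import Data.Bool using (true; T)
  open import Relation.Binary.PropositionalEquality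

  module _ (S : List (ℕ × ℕ)) (K : ℕ) (K≤ : K ℕ.≤ Blocks.size S K)
           (solution : RandomizedSolution (BlockInstance.blocks S K)) where

    open BlockInstance S K using (value; value-mono; total-value≤best; Opt≥)
    open Words S K K≤ solution
    open RandomizedSolution solution using (Competitive)

    top : ℕ → ℕ
    top k = peak S 0 (λ _ → k)

    -- The competitiveness inequalities are multiplied by their weights and added. Their right-hand
    -- sides merge by `𝔼-linear` because all expectations now range over the same words.
    top-total≤ : ∀ {α} → BoundedFactor α → Competitive α → ∀ Ts → All (λ t → proj₁ t ℕ.≤ K) Ts →
      fromℚ (ι (total Ts top)) D.≤ α D.* 𝔼 all (λ W → total Ts (value W))
    top-total≤ {α} bf comp [] [] = ≤-trans {0ℝ} {α D.* 0ℝ} {α D.* 𝔼 all (λ _ → 0)}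
      (≤-≡ {0ℝ} {α D.* 0ℝ} λ n → sym (ℚₚ.*-zeroʳ (seq α n)))
      (*-mono {α} {0ℝ} {𝔼 all (λ _ → 0)} bf (∑-nonneg (λ W → P W D.* 0ℝ)
        (λ W → ≤-≡ {0ℝ} {P W D.* 0ℝ} λ n → sym (ℚₚ.*-zeroʳ (seq (P W) n))) all))
    top-total≤ {α} bf comp ((k , p) ∷ Ts) (k≤K ∷ Ts≤K) with comp k (ℕₚ.≤-trans k≤K K≤)
    ... | v , isExp , opt≤ =
      ≤-trans {fromℚ (ι (total ((k , p) ∷ Ts) top))} {fromℚ (ι p) D.* fromℚ (ι (top k)) D.+ fromℚ (ι (total Ts top))} {rhs}
        (≤-≡ {fromℚ (ι (total ((k , p) ∷ Ts) top))} {fromℚ (ι p) D.* fromℚ (ι (top k)) D.+ fromℚ (ι (total Ts top))}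
          λ _ → trans (ι-+ (p ℕ.* top k) (total Ts top)) (cong (ℚ._+ ι (total Ts top)) (ι-* p (top k))))
        (≤-trans {fromℚ (ι p) D.* fromℚ (ι (top k)) D.+ fromℚ (ι (total Ts top))} {mid} {rhs}
          (+-mono {fromℚ (ι p) D.* fromℚ (ι (top k))} {fromℚ (ι p) D.* (α D.* 𝔼 all now)} {fromℚ (ι (total Ts top))} {α D.* 𝔼 all later}
            (*-mono {fromℚ (ι p)} {fromℚ (ι (top k))} {α D.* 𝔼 all now} (ι-factor p) top≤)
            (top-total≤ {α} bf comp Ts Ts≤K))
          (≤-≡ {mid} {rhs} λ n → trans
            (rearrange (ι p) (seq α n) (seq (𝔼 all now) n) (seq (𝔼 all later) n))
            (cong (seq α n ℚ.*_) (𝔼-linear all p now later n))))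
      where
      now later : _ → ℕ
      now   W = value W k
      later W = total Ts (value W)
      mid = fromℚ (ι p) D.* (α D.* 𝔼 all now) D.+ α D.* 𝔼 all later
      rhs = α D.* 𝔼 all (λ W → total ((k , p) ∷ Ts) (value W))
      top≤ : fromℚ (ι (top k)) D.≤ α D.* 𝔼 all now
      top≤ = ≤-trans {fromℚ (ι (top k))} {D.Instance.Opt (BlockInstance.blocks S K) k (ℕₚ.≤-trans k≤K K≤)} {α D.* 𝔼 all now}
        (Opt≥ k (ℕₚ.≤-trans k≤K K≤) k≤K)
        (≤-trans {D.Instance.Opt (BlockInstance.blocks S K) k (ℕₚ.≤-trans k≤K K≤)} {α D.* v} {α D.* 𝔼 all now} opt≤
          (*-mono {α} {v} {𝔼 all now} bf (expected≤ k≤K (ℕₚ.≤-trans k≤K K≤) {v} isExp)))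
      rearrange : ∀ p a x y → p ℚ.* (a ℚ.* x) ℚ.+ a ℚ.* y ≡ a ℚ.* (p ℚ.* x ℚ.+ y)
      rearrange = solve 4 (λ p a x y → p :* (a :* x) :+ a :* y := a :* (p :* x :+ y)) refl
        where open +-*-Solver

    top-total≤α* : ∀ {α V} → 1ℝ D.≤ α → Competitive α → ∀ Ts → All (λ t → proj₁ t ℕ.≤ K) Ts →
      AllPairs (λ t u → proj₁ t ℕ.≤ proj₁ u) Ts → Denser S → best Ts S 0 (λ _ → 0) 0 ℕ.≤ V →
      fromℚ (ι (total Ts top)) D.≤ α D.* fromℚ (ι V)
    top-total≤α* {α} {V} 1≤α comp Ts Ts≤K sorted denser best≤V =
      ≤-trans {fromℚ (ι (total Ts top))} {α D.* 𝔼 all (λ W → total Ts (value W))} {α D.* fromℚ (ι V)}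
        (top-total≤ {α} bf comp Ts Ts≤K)
        (*-mono {α} {𝔼 all (λ W → total Ts (value W))} {fromℚ (ι V)} bf
          -- The constant `V` is written as `V * 1 + 0` to match `𝔼-linear`, which reduces its
          -- expectation to the total probability.
          (≤-trans {𝔼 all (λ W → total Ts (value W))} {𝔼 all (λ _ → V ℕ.* 1 ℕ.+ 0)} {fromℚ (ι V)}
            (𝔼-mono all λ W → ℕₚ.≤-trans (total-value≤best W Ts sorted denser)
              (ℕₚ.≤-trans best≤V (ℕₚ.≤-reflexive (sym (trans (ℕₚ.+-identityʳ _) (ℕₚ.*-identityʳ V))))))
            (≤-trans {𝔼 all (λ _ → V ℕ.* 1 ℕ.+ 0)} {fromℚ (ι V) D.* 𝔼 all (λ _ → 1)} {fromℚ (ι V)}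
              (≤-≡ {𝔼 all (λ _ → V ℕ.* 1 ℕ.+ 0)} {fromℚ (ι V) D.* 𝔼 all (λ _ → 1)} λ n →
                trans (sym (𝔼-linear all V (λ _ → 1) (λ _ → 0) n))
                  (trans (cong (ι V ℚ.* seq (𝔼 all (λ _ → 1)) n ℚ.+_) (𝔼-zero all n)) (ℚₚ.+-identityʳ _)))
              (≤-trans {fromℚ (ι V) D.* 𝔼 all (λ _ → 1)} {fromℚ (ι V) D.* 1ℝ} {fromℚ (ι V)}
                (*-mono {fromℚ (ι V)} {𝔼 all (λ _ → 1)} {1ℝ} (ι-factor V) 𝔼1≤1)
                (≤-≡ {fromℚ (ι V) D.* 1ℝ} {fromℚ (ι V)} λ _ → ℚₚ.*-identityʳ (ι V))))))
      where
      bf = ≥1-factor α 1≤α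
      𝔼-zero : ∀ Ws n → seq (𝔼 Ws (λ _ → 0)) n ≡ 0ℚ
      𝔼-zero []       n = refl
      𝔼-zero (W ∷ Ws) n = cong₂ ℚ._+_ (ℚₚ.*-zeroʳ (seq (P W) n)) (𝔼-zero Ws n)

  -- The inequality between limits is used with slack `ε * ι V`, so that cancelling `V` leaves
  -- exactly `ε`.
  ratio≤ : ∀ {α a b o V} .{{_ : NonZero b}} .{{_ : NonZero V}} → a ℕ.* V ℕ.≤ b ℕ.* o →
    fromℚ (ι o) D.≤ α D.* fromℚ (ι V) → fromℚ (+ a ℚ./ b) D.≤ α
  ratio≤ {α} {a} {b} {o} {V} aV≤bo le ε 0<ε with le (ε ℚ.* ι V) 0<εV
    where
    0<εV : 0ℚ ℚ.< ε ℚ.* ι V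
    0<εV = ℚₚ.positive⁻¹ _ {{ℚₚ.pos*pos⇒pos ε {{ℚ.positive 0<ε}} (ι V) {{ι-pos V}}}}
  ... | N , p = N , λ n N≤n → ℚₚ.*-cancelʳ-≤-pos (ι V) {{ι-pos V}} (begin
    r ℚ.* ι V                         ≤⟨ rV≤o ⟩
    ι o                               ≤⟨ p n N≤n ⟩
    seq α n ℚ.* ι V ℚ.+ ε ℚ.* ι V      ≡⟨ sym (ℚₚ.*-distribʳ-+ (ι V) (seq α n) ε) ⟩
    (seq α n ℚ.+ ε) ℚ.* ι V            ∎)
    where
    open ℚₚ.≤-Reasoning
    r = + a ℚ./ b
    rV≤o : r ℚ.* ι V ℚ.≤ ι o
    rV≤o = ℚₚ.*-cancelˡ-≤-pos (ι b) {{ι-pos b}} (begin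
      ι b ℚ.* (r ℚ.* ι V)   ≡⟨ sym (ℚₚ.*-assoc (ι b) r (ι V)) ⟩
      (ι b ℚ.* r) ℚ.* ι V   ≡⟨ cong (ℚ._* ι V) (ι-/ a b) ⟩
      ι a ℚ.* ι V           ≡⟨ sym (ι-* a V) ⟩
      ι (a ℕ.* V)           ≤⟨ ι-mono aV≤bo ⟩
      ι (b ℕ.* o)           ≡⟨ ι-* b o ⟩
      ι b ℚ.* ι o           ∎)

  ratio-bound : ∀ S K Ts V a b .{{_ : NonZero b}} .{{_ : NonZero V}} → K ℕ.≤ Blocks.size S K →
    AllPairs (λ t u → proj₁ t ℕ.≤ proj₁ u) Ts → All (λ t → proj₁ t ℕ.≤ K) Ts → Denser S →
    check Ts V S 0 (rows Ts (λ _ → 0)) 0 ≡ true →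
    (a ℕ.* V ℕ.≤ᵇ b ℕ.* total Ts (λ k → peak′ S 0 (λ _ → k))) ≡ true →
    (A : RandomizedAlgorithm) → CompetitiveRatioAtLeast (fromℚ (+ a ℚ./ b)) A
  ratio-bound S K Ts V a b K≤ sorted Ts≤K denser checked gap A α (1≤α , competitive) =
    ratio≤ {α} {a} {b} {total Ts (λ k → peak S 0 (λ _ → k))} {V}
      (subst (λ x → a ℕ.* V ℕ.≤ b ℕ.* x)
        (total-cong Ts λ k → sym (peak≡peak′ S 0 (λ _ → k)))
        (ℕₚ.≤ᵇ⇒≤ (a ℕ.* V) (b ℕ.* total Ts (λ k → peak′ S 0 (λ _ → k))) (subst T (sym gap) tt)))
      (top-total≤α* S K K≤ (A (BlockInstance.blocks S K)) {α} {V} 1≤α (competitive (BlockInstance.blocks S K))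
        Ts Ts≤K sorted denser (check-sound Ts S (subst T (sym checked) tt)))

-- The numerical certificate.

module Certificate where

  open Schedules
  open import Data.Bool using (true)
  open import Data.List using (List; []; _∷_)
  open import Data.List.Relation.Unary.All as All using (All)
  open import Data.List.Relation.Unary.AllPairs using (AllPairs; allPairs?)
  open import Data.Nat as ℕ using (ℕ)
  open import Data.Product using (_×_; _,_; proj₁; proj₂)
  open import Data.Unit using (tt)
  open import Relation.Binary.PropositionalEquality using (_≡_; refl)
  open import Relation.Nullary.Decidable using (toWitness)

  -- (size , density) and (time , weight); found by alternating linear programming
  -- in the weights with a local search over sizes and densities.
  sets weights : List (ℕ × ℕ)
  sets = (12 , 12000) ∷ (53 , 6216) ∷ (203 , 3660) ∷ (715 , 2257) ∷ (2417 , 1425) ∷ (7996 , 919) ∷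
    (25869 , 599) ∷ (80577 , 400) ∷ (235921 , 277) ∷ (657661 , 202) ∷ (1530076 , 152) ∷ []
  weights = (12 , 15888) ∷ (53 , 18839) ∷ (203 , 15173) ∷ (715 , 9433) ∷ (2417 , 5484) ∷ (7996 , 2947) ∷
    (25869 , 1536) ∷ (80577 , 741) ∷ (235921 , 326) ∷ (657661 , 122) ∷ (1530076 , 40) ∷ []

  largestSize : ℕ
  largestSize = 1530076

  -- The largest `V` that `gap` permits: the weighted sum of optima is 170032326377, and
  -- `1447 * threshold` falls short of 1000 times that by 1133. A larger `V` prunes the search
  -- earlier.
  threshold : ℕ
  threshold = 117506790861

  verified : check weights threshold sets 0 (rows weights (λ _ → 0)) 0 ≡ true
  verified = refl

  gap : (1447 ℕ.* threshold ℕ.≤ᵇ 1000 ℕ.* total weights (λ k → peak′ sets 0 (λ _ → k))) ≡ true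
  gap = refl

  sorted : AllPairs (λ t u → proj₁ t ℕ.≤ proj₁ u) weights
  sorted = toWitness {a? = allPairs? (λ t u → proj₁ t ℕ.≤? proj₁ u) weights} tt

  denser : Denser sets
  denser = toWitness {a? = allPairs? (λ t u → proj₂ u ℕ.≤? proj₂ t) sets} tt

  in-range : All (λ t → proj₁ t ℕ.≤ largestSize) weights
  in-range = toWitness {a? = All.all? (λ t → proj₁ t ℕ.≤? largestSize) weights} tt

open import Defs
open import Data.Integer using (+_)
open import Data.Rational using (_/_)
open import Data.Nat.Properties using (m≤n*m)
open LowerBound using (ratio-bound)
open Certificate

theorem6 : (A : RandomizedAlgorithm) → CompetitiveRatioAtLeast (fromℚ (+ 1447 / 1000)) A
theorem6 = ratio-bound sets largestSize weights threshold 1447 1000 (m≤n*m largestSize 11)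
  sorted in-range denser verified gap
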